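{- Let $\mathbf{L}^*$ be any one of the quantified modal logics $\mathbf{Tm}^*$, $\mathbf{S4m}^*$, $\mathbf{S5m}^*$, and let $\Gamma\cup\{\varphi\}\subseteq For(\Theta)$ be a set of formulas over a basic predicate signature $\Theta$. Then $\Gamma\models_{\mathbf{L}^*}\varphi$ if and only if $\Gamma\vdash_{\mathbf{L}^*}\varphi$.
   Context: Syntax. A basic predicate signature $\Theta$ consists of a nonempty set of predicate symbols $P$, each with an arity $\geq 1$, and a possibly empty set $C$ of individual constants (no function symbols, no equality). Variables are $x_1,x_2,\ldots$; terms are variables or constants. Formulas $For(\Theta)$: $P\tau_1\ldots\tau_n$ is atomic; if $\varphi,\psi$ are formulas and $x$ a variable then $\neg\varphi$, $\Box\varphi$, $\forall x\varphi$, $\varphi\to\psi$ are formulas. $\exists x\varphi$ abbreviates $\neg\forall x\neg\varphi$. $\varphi[x/\tau]$ is the result of simultaneously replacing all free occurrences of $x$ by $\tau$ ($\tau$ free for $x$ in $\varphi$). $Sen(\Theta)$ is the set of closed formulas. Two formulas are variants, $\varphi\sim\psi$, if one is obtained from the other by adding or deleting void quantifiers ($\forall x\gamma$ or $\exists x\gamma$ with $x$ not free in $\gamma$) or by renaming bound variables (keeping the same free variables in the same places). Truth values: $\{\mathsf T,\mathsf t,\mathsf f,\mathsf F\}$ (necessarily true, contingently true, contingently false, necessarily false), designated values $\{\mathsf T,\mathsf t\}$. Multioperators: $\tilde\neg\mathsf T=\{\mathsf F\}$, $\tilde\neg\mathsf t=\{\mathsf f\}$, $\tilde\neg\mathsf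 f=\{\mathsf t\}$, $\tilde\neg\mathsf F=\{\mathsf T\}$. $a\,\tilde\to\, b$ (row $a$, column $b$ in order $\mathsf T,\mathsf t,\mathsf f,\mathsf F$): row $\mathsf T$: $\{\mathsf T\},\{\mathsf t\},\{\mathsf f\},\{\mathsf F\}$; row $\mathsf t$: $\{\mathsf T\},\{\mathsf T,\mathsf t\},\{\mathsf f\},\{\mathsf f\}$; row $\mathsf f$: $\{\mathsf T\},\{\mathsf T,\mathsf t\},\{\mathsf T,\mathsf t\},\{\mathsf t\}$; row $\mathsf F$: $\{\mathsf T\},\{\mathsf T\},\{\mathsf T\},\{\mathsf T\}$. $\tilde\Box_1\mathsf T=\{\mathsf T,\mathsf t\}$ and $\tilde\Box_1 a=\{\mathsf f,\mathsf F\}$ for $a\ne\mathsf T$; $\tilde\Box_2\mathsf T=\{\mathsf T\}$ and $\tilde\Box_2 a=\{\mathsf f,\mathsf F\}$ for $a\neq\mathsf T$; $\tilde\Box_3\mathsf T=\{\mathsf T\}$ and $\tilde\Box_3 a=\{\mathsf F\}$ for $a\neq \mathsf T$. For nonempty $X\subseteq\{\mathsf T,\mathsf t,\mathsf f,\mathsf F\}$, $\tilde\forall^d_4(X)=\{\min X\}$ with respect to the order $\mathsf F<\mathsf f<\mathsf t<\mathsf T$. Structures. A four-valued modal structure over $\Theta$ is $\mathfrak A=\langle U,\cdot^{\mathfrak A}\rangle$ with $U\neq\emptyset$, $P^{\mathfrak A}:U^n\to\{\mathsf T,\mathsf t,\mathsf f,\mathsf F\}$ for each $n$-ary $P$, and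 $c^{\mathfrak A}\in U$ for each constant $c$. Let $\bar U=\{\bar a: a\in U\setminus C^{\mathfrak A}\}$ be new constants, $\Theta_U$ the signature $\Theta$ plus $\bar U$, and $\mathfrak A_U$ the expansion with $\bar a^{\mathfrak A_U}=a$. A $\mathbf{Tm}^*$-valuation over $\mathfrak A$ is a function $v:Sen(\Theta_U)\to\{\mathsf T,\mathsf t,\mathsf f,\mathsf F\}$ such that: (1) $v(Pc_1\ldots c_n)=P^{\mathfrak A}(c_1^{\mathfrak A_U},\ldots,c_n^{\mathfrak A_U})$; (2) $v(\neg\varphi)\in\tilde\neg v(\varphi)$; (3) $v(\Box\varphi)\in\tilde\Box_1 v(\varphi)$; (4) $v(\varphi\to\psi)\in v(\varphi)\tilde\to v(\psi)$; (5) $v(\forall x\varphi)\in\tilde\forall^d_4(\{v(\varphi[x/c]):c\in C\cup\bar U\})$; (6) if $\varphi\sim\varphi'$ then $v(\varphi)=v(\varphi')$. $\mathbf{S4m}^*$-valuations (resp. $\mathbf{S5m}^*$-valuations) are defined identically but with $\tilde\Box_2$ (resp. $\tilde\Box_3$) in clause (3). Semantic consequence: for $\Gamma\cup\{\varphi\}\subseteq For(\Theta)$ with all free variables among $x_1,\ldots,x_n$, $\Gamma\models_{\mathbf L^*}\varphi$ iff for every structure $\mathfrak A$ over $\Theta$ and every $\mathbf L^*$-valuation $v$ over $\mathfrak A$: if $v(\gamma[x_1/c_1\cdots x_n/c_n])\in\{\mathsf T,\mathsf t\}$ for every $\gamma\in\Gamma$ and all $c_1,\ldots,c_n\in C\cup\bar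 U$, then $v(\varphi[x_1/c_1\cdots x_n/c_n])\in\{\mathsf T,\mathsf t\}$ for all $c_1,\ldots,c_n\in C\cup\bar U$. Hilbert calculi. Axiom schemas: (Ax1) $\varphi\to(\psi\to\varphi)$; (Ax2) $(\varphi\to(\psi\to\xi))\to((\varphi\to\psi)\to(\varphi\to\xi))$; (Ax3) $(\neg\psi\to\neg\varphi)\to((\neg\psi\to\varphi)\to\psi)$; (Ax4) $\forall x\varphi\to\varphi[x/\tau]$ if $\tau$ is free for $x$ in $\varphi$; (Ax5) $\forall x(\varphi\to\psi)\to(\varphi\to\forall x\psi)$ if $x$ not free in $\varphi$; (Ax6) $\varphi\to\psi$ if $\varphi\sim\psi$; (K) $\Box(\varphi\to\psi)\to(\Box\varphi\to\Box\psi)$; (K1) $\Box(\varphi\to\psi)\to(\Box\neg\psi\to\Box\neg\varphi)$; (K2) $\neg\Box\neg(\varphi\to\psi)\to(\Box\varphi\to\neg\Box\neg\psi)$; (M1) $\Box\neg\varphi\to\Box(\varphi\to\psi)$; (M2) $\Box\psi\to\Box(\varphi\to\psi)$; (M3) $\neg\Box\neg\psi\to\neg\Box\neg(\varphi\to\psi)$; (M4) $\neg\Box\neg\neg\varphi\to\neg\Box\neg(\varphi\to\psi)$; (T) $\Box\varphi\to\varphi$; (4) $\neg\Box\neg\Box\varphi\to\Box\varphi$; (5) $\Box\varphi\to\Box\Box\varphi$; (DN1) $\Box\varphi\to\Box\neg\neg\varphi$; (DN2) $\Box\neg\neg\varphi\to\Box\varphi$; (BF) $\forall x\Box\varphi\to\Box\forall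 x\varphi$; (CBF) $\Box\forall x\varphi\to\forall x\Box\varphi$; (NBF) $\forall x\neg\Box\neg\varphi\to\neg\Box\neg\forall x\varphi$; (PBF) $\neg\Box\neg\forall x\varphi\to\forall x\neg\Box\neg\varphi$. Rules: MP (from $\varphi$ and $\varphi\to\psi$ infer $\psi$) and Gen (from $\varphi$ infer $\forall x\varphi$). $\mathbf{Tm}^*$ has axioms (Ax1)–(Ax5), (K), (K1), (K2), (M1)–(M4), (T), (DN1), (DN2), (BF), (CBF), (NBF), (PBF), and rules MP, Gen; $\mathbf{S4m}^*$ is $\mathbf{Tm}^*$ plus (4); $\mathbf{S5m}^*$ is $\mathbf{S4m}^*$ plus (5). $\Gamma\vdash_{\mathbf L^*}\varphi$ means there is a derivation of $\varphi$ from $\Gamma$ in the usual sense.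
   Formalization: The calculi are corrected: S4m* adds □φ→□□φ to Tm* (as printed, ¬□¬□φ→□φ, unsound), S5m* adds ¬□¬□φ→□φ to that; and (Ax6), φ→ψ for variants φ∼ψ, is included among the axioms of all three logics, without which completeness fails. -}

module Defs where

open import Level using (Level; suc)
open import Data.Nat.Base as ℕ using (ℕ)
open import Data.Nat.Properties using (_≟_)
open import Data.Empty using (⊥-elim)
open import Data.Irrelevant as Irrelevant using (Irrelevant)
open import Data.Product.Base using (∃; _×_; _,_)
open import Data.Refinement using (Refinement-syntax; value)
  renaming (_,_ to _,ʳ_)
open import Data.Sum.Base using (_⊎_; inj₁; inj₂; [_,_]′)
open import Data.Unit.Polymorphic.Base using (⊤)
open import Data.Vec.Base as Vec using (Vec; _∷_)
open import Data.Vec.Membership.Propositional using () renaming (_∈_ to _∈ᵛ_)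
open import Data.Vec.Relation.Unary.Any using (here; there)
open import Relation.Binary.PropositionalEquality using (_≡_; _≢_; refl; sym)
open import Relation.Nullary.Decidable.Core using (yes; no)
open import Relation.Nullary.Negation.Core using (¬_)
open import Relation.Unary using (Pred; _∈_; ｛_｝; _∪_)

private
  variable
    ℓ : Level

record Signature (ℓ : Level) : Set (suc ℓ) where
  field
    PredSym   : Set ℓ
    somePred  : PredSym
    arity     : PredSym → ℕ
    arity≥1   : ∀ P → 1 ℕ.≤ arity P
    Const     : Set ℓ

open Signature public

Var : Set
Var = ℕ

data Term (Θ : Signature ℓ) : Set ℓ where
  var : Var → Term Θ
  con : Const Θ → Term Θ

infixr 20 _⇒_
infix  30 ¬̇_ □_ ◇_

data Formula (Θ : Signature ℓ) : Set ℓ where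
  atom : (P : PredSym Θ) → Vec (Term Θ) (arity Θ P) → Formula Θ
  ¬̇_   : Formula Θ → Formula Θ
  □_   : Formula Θ → Formula Θ
  _⇒_  : Formula Θ → Formula Θ → Formula Θ
  ∀̇    : Var → Formula Θ → Formula Θ

∃̇ : {Θ : Signature ℓ} → Var → Formula Θ → Formula Θ
∃̇ x φ = ¬̇ (∀̇ x (¬̇ φ))

◇_ : {Θ : Signature ℓ} → Formula Θ → Formula Θ
◇ φ = ¬̇ (□ (¬̇ φ))

infix 4 _FreeIn_

_FreeIn_ : {Θ : Signature ℓ} → Var → Formula Θ → Set ℓ
x FreeIn atom P τs = var x ∈ᵛ τs
x FreeIn (¬̇ φ)     = x FreeIn φ
x FreeIn (□ φ)     = x FreeIn φ
x FreeIn (φ ⇒ ψ)   = x FreeIn φ ⊎ x FreeIn ψ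
x FreeIn (∀̇ y φ)   = x ≢ y × x FreeIn φ

Closed : {Θ : Signature ℓ} → Formula Θ → Set ℓ
Closed φ = ∀ x → ¬ (x FreeIn φ)

-- Closedness is proof irrelevant, so a sentence is determined by its formula.
Sen : Signature ℓ → Set ℓ
Sen Θ = [ φ ∈ Formula Θ ∣ Closed φ ]

Subst : Signature ℓ → Set ℓ
Subst Θ = Var → Term Θ

infixl 40 _[_↦_]

_[_↦_] : {Θ : Signature ℓ} → Subst Θ → Var → Term Θ → Subst Θ
(σ [ x ↦ τ ]) y with y ≟ x
... | yes _ = τ
... | no  _ = σ y

substTerm : {Θ : Signature ℓ} → Subst Θ → Term Θ → Term Θ
substTerm σ (var x) = σ x
substTerm σ (con c) = con c

-- Simultaneous replacement of the free occurrences of all variables; bound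
-- variables are never renamed, so capture has to be excluded separately.
subst : {Θ : Signature ℓ} → Subst Θ → Formula Θ → Formula Θ
subst σ (atom P τs) = atom P (Vec.map (substTerm σ) τs)
subst σ (¬̇ φ)       = ¬̇ (subst σ φ)
subst σ (□ φ)       = □ (subst σ φ)
subst σ (φ ⇒ ψ)     = subst σ φ ⇒ subst σ ψ
subst σ (∀̇ x φ)     = ∀̇ x (subst (σ [ x ↦ var x ]) φ)

infixl 40 _[_/_]

_[_/_] : {Θ : Signature ℓ} → Formula Θ → Var → Term Θ → Formula Θ
φ [ x / τ ] = subst (var [ x ↦ τ ]) φ

-- No free occurrence of x in φ lies in the scope of a quantifier binding a
-- variable of τ.
FreeFor : {Θ : Signature ℓ} → Term Θ → Var → Formula Θ → Set ℓ
FreeFor τ x (atom P τs) = ⊤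
FreeFor τ x (¬̇ φ)       = FreeFor τ x φ
FreeFor τ x (□ φ)       = FreeFor τ x φ
FreeFor τ x (φ ⇒ ψ)     = FreeFor τ x φ × FreeFor τ x ψ
FreeFor τ x (∀̇ y φ)     = x FreeIn ∀̇ y φ → τ ≢ var y × FreeFor τ x φ

infix 4 _∼_

data _∼_ {Θ : Signature ℓ} : Formula Θ → Formula Θ → Set ℓ where
  ∼-refl  : ∀ {φ} → φ ∼ φ
  ∼-sym   : ∀ {φ ψ} → φ ∼ ψ → ψ ∼ φ
  ∼-trans : ∀ {φ ψ ξ} → φ ∼ ψ → ψ ∼ ξ → φ ∼ ξ
  ∼-¬     : ∀ {φ φ′} → φ ∼ φ′ → ¬̇ φ ∼ ¬̇ φ′
  ∼-□     : ∀ {φ φ′} → φ ∼ φ′ → □ φ ∼ □ φ′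
  ∼-⇒     : ∀ {φ φ′ ψ ψ′} → φ ∼ φ′ → ψ ∼ ψ′ → (φ ⇒ ψ) ∼ (φ′ ⇒ ψ′)
  ∼-∀     : ∀ {x φ φ′} → φ ∼ φ′ → ∀̇ x φ ∼ ∀̇ x φ′
  void-∀  : ∀ {x γ} → ¬ (x FreeIn γ) → ∀̇ x γ ∼ γ
  void-∃  : ∀ {x γ} → ¬ (x FreeIn γ) → ∃̇ x γ ∼ γ
  rename  : ∀ {x y φ} → ¬ (y FreeIn φ) → FreeFor (var y) x φ →
            ∀̇ x φ ∼ ∀̇ y (φ [ x / var y ])

-- Truth values

data TV : Set where
  𝐓 𝐭 𝐟 𝐅 : TV

Designated : Pred TV _
Designated = ｛ 𝐓 ｝ ∪ ｛ 𝐭 ｝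

rank : TV → ℕ
rank 𝐅 = 0
rank 𝐟 = 1
rank 𝐭 = 2
rank 𝐓 = 3

infix 4 _≤ᵗ_

_≤ᵗ_ : TV → TV → Set
a ≤ᵗ b = rank a ℕ.≤ rank b

¬̃ : TV → Pred TV _
¬̃ 𝐓 = ｛ 𝐅 ｝
¬̃ 𝐭 = ｛ 𝐟 ｝
¬̃ 𝐟 = ｛ 𝐭 ｝
¬̃ 𝐅 = ｛ 𝐓 ｝

infix 5 _→̃_

_→̃_ : TV → TV → Pred TV _
𝐓 →̃ 𝐓 = ｛ 𝐓 ｝
𝐓 →̃ 𝐭 = ｛ 𝐭 ｝
𝐓 →̃ 𝐟 = ｛ 𝐟 ｝
𝐓 →̃ 𝐅 = ｛ 𝐅 ｝
𝐭 →̃ 𝐓 = ｛ 𝐓 ｝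
𝐭 →̃ 𝐭 = ｛ 𝐓 ｝ ∪ ｛ 𝐭 ｝
𝐭 →̃ 𝐟 = ｛ 𝐟 ｝
𝐭 →̃ 𝐅 = ｛ 𝐟 ｝
𝐟 →̃ 𝐓 = ｛ 𝐓 ｝
𝐟 →̃ 𝐭 = ｛ 𝐓 ｝ ∪ ｛ 𝐭 ｝
𝐟 →̃ 𝐟 = ｛ 𝐓 ｝ ∪ ｛ 𝐭 ｝
𝐟 →̃ 𝐅 = ｛ 𝐭 ｝
𝐅 →̃ 𝐓 = ｛ 𝐓 ｝
𝐅 →̃ 𝐭 = ｛ 𝐓 ｝
𝐅 →̃ 𝐟 = ｛ 𝐓 ｝
𝐅 →̃ 𝐅 = ｛ 𝐓 ｝

data Logic : Set where
  Tm* S4m* S5m* : Logic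

□̃₁ □̃₂ □̃₃ : TV → Pred TV _
□̃₁ 𝐓 = ｛ 𝐓 ｝ ∪ ｛ 𝐭 ｝
□̃₁ 𝐭 = ｛ 𝐟 ｝ ∪ ｛ 𝐅 ｝
□̃₁ 𝐟 = ｛ 𝐟 ｝ ∪ ｛ 𝐅 ｝
□̃₁ 𝐅 = ｛ 𝐟 ｝ ∪ ｛ 𝐅 ｝

□̃₂ 𝐓 = ｛ 𝐓 ｝
□̃₂ 𝐭 = ｛ 𝐟 ｝ ∪ ｛ 𝐅 ｝
□̃₂ 𝐟 = ｛ 𝐟 ｝ ∪ ｛ 𝐅 ｝
□̃₂ 𝐅 = ｛ 𝐟 ｝ ∪ ｛ 𝐅 ｝

□̃₃ 𝐓 = ｛ 𝐓 ｝
□̃₃ 𝐭 = ｛ 𝐅 ｝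
□̃₃ 𝐟 = ｛ 𝐅 ｝
□̃₃ 𝐅 = ｛ 𝐅 ｝

□̃ : Logic → TV → Pred TV _
□̃ Tm*  = □̃₁
□̃ S4m* = □̃₂
□̃ S5m* = □̃₃

-- ∀̃ X = { min X }
∀̃ : Pred TV ℓ → Pred TV ℓ
∀̃ X m = m ∈ X × (∀ {a} → a ∈ X → m ≤ᵗ a)

record Structure (Θ : Signature ℓ) : Set (suc ℓ) where
  field
    U        : Set ℓ
    nonempty : U
    ⟦_⟧ᵖ     : (P : PredSym Θ) → Vec U (arity Θ P) → TV
    ⟦_⟧ᶜ     : Const Θ → U

module _ {Θ : Signature ℓ} (𝔄 : Structure Θ) where
  open Structure 𝔄

  -- U ∖ C^𝔄
  Ū : Set ℓ
  Ū = [ a ∈ U ∣ ¬ (∃ λ (c : Const Θ) → ⟦ c ⟧ᶜ ≡ a) ]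

  diagramSig : Signature ℓ
  diagramSig = record
    { PredSym  = PredSym Θ
    ; somePred = somePred Θ
    ; arity    = arity Θ
    ; arity≥1  = arity≥1 Θ
    ; Const    = Const Θ ⊎ Ū
    }

  expansion : Structure diagramSig
  expansion = record
    { U        = U
    ; nonempty = nonempty
    ; ⟦_⟧ᵖ     = ⟦_⟧ᵖ
    ; ⟦_⟧ᶜ     = [ ⟦_⟧ᶜ , value ]′
    }

  embedTerm : Term Θ → Term diagramSig
  embedTerm (var x) = var x
  embedTerm (con c) = con (inj₁ c)

  embed : Formula Θ → Formula diagramSig
  embed (atom P τs) = atom P (Vec.map embedTerm τs)
  embed (¬̇ φ)       = ¬̇ (embed φ)
  embed (□ φ)       = □ (embed φ)
  embed (φ ⇒ ψ)     = embed φ ⇒ embed ψ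
  embed (∀̇ x φ)     = ∀̇ x (embed φ)

module _ {Θ : Signature ℓ} where

  free-substTerms : ∀ {n} (σ : Subst Θ) (τs : Vec (Term Θ) n) {y} →
    var y ∈ᵛ Vec.map (substTerm σ) τs →
    ∃ λ x → var x ∈ᵛ τs × σ x ≡ var y
  free-substTerms σ (var x ∷ τs) (here eq) = x , here refl , sym eq
  free-substTerms σ (con c ∷ τs) (here ())
  free-substTerms σ (τ ∷ τs) (there p) with free-substTerms σ τs p
  ... | x , q , eq = x , there q , eq

  free-subst : (σ : Subst Θ) (φ : Formula Θ) {y : Var} →
    y FreeIn subst σ φ → ∃ λ x → x FreeIn φ × σ x ≡ var y
  free-subst σ (atom P τs) p = free-substTerms σ τs p
  free-subst σ (¬̇ φ) p = free-subst σ φ p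
  free-subst σ (□ φ) p = free-subst σ φ p
  free-subst σ (φ ⇒ ψ) (inj₁ p) with free-subst σ φ p
  ... | x , q , eq = x , inj₁ q , eq
  free-subst σ (φ ⇒ ψ) (inj₂ p) with free-subst σ ψ p
  ... | x , q , eq = x , inj₂ q , eq
  free-subst σ (∀̇ z φ) (y≢z , p) with free-subst (σ [ z ↦ var z ]) φ p
  ... | x , q , eq with x ≟ z
  free-subst σ (∀̇ z φ) (y≢z , p) | x , q , refl | yes _ = ⊥-elim (y≢z refl)
  free-subst σ (∀̇ z φ) (y≢z , p) | x , q , eq   | no x≢z = x , (x≢z , q) , eq

  closed-⇒ : ∀ {φ ψ : Formula Θ} → Closed φ → Closed ψ → Closed (φ ⇒ ψ)
  closed-⇒ p q x = [ p x , q x ]′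

  closed-atom : ∀ P (cs : Vec (Const Θ) (arity Θ P)) →
    Closed (atom {Θ = Θ} P (Vec.map con cs))
  closed-atom P cs x = go cs
    where
    go : ∀ {n} (cs : Vec (Const Θ) n) → ¬ (var x ∈ᵛ Vec.map (con {Θ = Θ}) cs)
    go (c ∷ cs) (here ())
    go (c ∷ cs) (there p) = go cs p

  closed-ground : (s : Var → Const Θ) (φ : Formula Θ) →
    Closed (subst (λ x → con (s x)) φ)
  closed-ground s φ y p with free-subst (λ x → con (s x)) φ p
  ... | x , q , ()

  closed-instance : ∀ x (φ : Formula Θ) (c : Const Θ) →
    Closed (∀̇ x φ) → Closed (φ [ x / con c ])
  closed-instance x φ c p y q with free-subst (var [ x ↦ con c ]) φ q
  ... | z , r , eq with z ≟ x
  closed-instance x φ c p y q | z , r , ()   | yes _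
  closed-instance x φ c p y q | z , r , refl | no z≢x = p z (z≢x , r)

  atomˢ : ∀ P → Vec (Const Θ) (arity Θ P) → Sen Θ
  atomˢ P cs = atom P (Vec.map con cs) ,ʳ Irrelevant.pure (closed-atom P cs)

  ¬ˢ_ □ˢ_ : Sen Θ → Sen Θ
  ¬ˢ (φ ,ʳ p) = ¬̇ φ ,ʳ p
  □ˢ (φ ,ʳ p) = □ φ ,ʳ p

  _⇒ˢ_ : Sen Θ → Sen Θ → Sen Θ
  (φ ,ʳ p) ⇒ˢ (ψ ,ʳ q) = φ ⇒ ψ ,ʳ Irrelevant.zipWith (closed-⇒ {φ} {ψ}) p q

  groundˢ : (Var → Const Θ) → Formula Θ → Sen Θ
  groundˢ s φ = subst (λ x → con (s x)) φ ,ʳ Irrelevant.pure (closed-ground s φ)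

  instanceˢ : ∀ x φ → Irrelevant (Closed (∀̇ x φ)) → Const Θ → Sen Θ
  instanceˢ x φ p c = φ [ x / con c ] ,ʳ Irrelevant.map (closed-instance x φ c) p

record Valuation (L : Logic) {Θ : Signature ℓ} (𝔄 : Structure Θ) : Set ℓ where
  open Structure (expansion 𝔄) using (⟦_⟧ᵖ; ⟦_⟧ᶜ)
  field
    v      : Sen (diagramSig 𝔄) → TV
    v-atom : ∀ P cs → v (atomˢ P cs) ≡ ⟦ P ⟧ᵖ (Vec.map ⟦_⟧ᶜ cs)
    v-¬    : ∀ φ → v (¬ˢ φ) ∈ ¬̃ (v φ)
    v-□    : ∀ φ → v (□ˢ φ) ∈ □̃ L (v φ)
    v-⇒    : ∀ φ ψ → v (φ ⇒ˢ ψ) ∈ (v φ →̃ v ψ)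
    v-∀    : ∀ x φ (p : Irrelevant (Closed (∀̇ x φ))) →
            v (∀̇ x φ ,ʳ p) ∈ ∀̃ (λ a → ∃ λ c → v (instanceˢ x φ p c) ≡ a)
    v-∼    : ∀ {φ ψ} → value φ ∼ value ψ → v φ ≡ v ψ

-- The substitution [x₁/c₁ ⋯ xₙ/cₙ] is given by an assignment of constants to
-- all variables; Γ may contain infinitely many free variables.
infix 3 _⊨⟨_⟩_ _⊢⟨_⟩_

_⊨⟨_⟩_ : {Θ : Signature ℓ} → Pred (Formula Θ) ℓ → Logic → Formula Θ → Set (suc ℓ)
_⊨⟨_⟩_ {Θ = Θ} Γ L φ = (𝔄 : Structure Θ) (V : Valuation L 𝔄) →
  let open Valuation V in
  (∀ {γ} → γ ∈ Γ → ∀ s → v (groundˢ s (embed 𝔄 γ)) ∈ Designated) →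
  ∀ s → v (groundˢ s (embed 𝔄 φ)) ∈ Designated

data TmAxiom {Θ : Signature ℓ} : Pred (Formula Θ) ℓ where
  Ax1 : ∀ φ ψ → TmAxiom (φ ⇒ ψ ⇒ φ)
  Ax2 : ∀ φ ψ ξ → TmAxiom ((φ ⇒ ψ ⇒ ξ) ⇒ (φ ⇒ ψ) ⇒ φ ⇒ ξ)
  Ax3 : ∀ φ ψ → TmAxiom ((¬̇ ψ ⇒ ¬̇ φ) ⇒ (¬̇ ψ ⇒ φ) ⇒ ψ)
  Ax4 : ∀ x φ τ → FreeFor τ x φ → TmAxiom (∀̇ x φ ⇒ φ [ x / τ ])
  Ax5 : ∀ x φ ψ → ¬ (x FreeIn φ) → TmAxiom (∀̇ x (φ ⇒ ψ) ⇒ φ ⇒ ∀̇ x ψ)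
  -- Needed for v-∼ and independent: the other axioms and rules are sound also
  -- when v-∼ is dropped, and then □□∀x Px ⇒ □□∀y Py can fail.
  Ax6 : ∀ φ ψ → φ ∼ ψ → TmAxiom (φ ⇒ ψ)
  K   : ∀ φ ψ → TmAxiom (□ (φ ⇒ ψ) ⇒ □ φ ⇒ □ ψ)
  K1  : ∀ φ ψ → TmAxiom (□ (φ ⇒ ψ) ⇒ □ (¬̇ ψ) ⇒ □ (¬̇ φ))
  K2  : ∀ φ ψ → TmAxiom (◇ (φ ⇒ ψ) ⇒ □ φ ⇒ ◇ ψ)
  M1  : ∀ φ ψ → TmAxiom (□ (¬̇ φ) ⇒ □ (φ ⇒ ψ))
  M2  : ∀ φ ψ → TmAxiom (□ ψ ⇒ □ (φ ⇒ ψ))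
  M3  : ∀ φ ψ → TmAxiom (◇ ψ ⇒ ◇ (φ ⇒ ψ))
  M4  : ∀ φ ψ → TmAxiom (◇ (¬̇ φ) ⇒ ◇ (φ ⇒ ψ))
  T   : ∀ φ → TmAxiom (□ φ ⇒ φ)
  DN1 : ∀ φ → TmAxiom (□ φ ⇒ □ (¬̇ (¬̇ φ)))
  DN2 : ∀ φ → TmAxiom (□ (¬̇ (¬̇ φ)) ⇒ □ φ)
  BF  : ∀ x φ → TmAxiom (∀̇ x (□ φ) ⇒ □ (∀̇ x φ))
  CBF : ∀ x φ → TmAxiom (□ (∀̇ x φ) ⇒ ∀̇ x (□ φ))
  NBF : ∀ x φ → TmAxiom (∀̇ x (◇ φ) ⇒ ◇ (∀̇ x φ))
  PBF : ∀ x φ → TmAxiom (◇ (∀̇ x φ) ⇒ ∀̇ x (◇ φ))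

-- The schemas carry their standard modal names: the one valid for □̃₂ is
-- □φ → □□φ, whereas ◇□φ → □φ fails for □̃₂ and holds for □̃₃.
data S4mAxiom {Θ : Signature ℓ} : Pred (Formula Θ) ℓ where
  Tm   : ∀ {φ} → TmAxiom φ → S4mAxiom φ
  four : ∀ φ → S4mAxiom (□ φ ⇒ □ (□ φ))

data S5mAxiom {Θ : Signature ℓ} : Pred (Formula Θ) ℓ where
  S4m  : ∀ {φ} → S4mAxiom φ → S5mAxiom φ
  five : ∀ φ → S5mAxiom (◇ (□ φ) ⇒ □ φ)

Axiom : Logic → {Θ : Signature ℓ} → Pred (Formula Θ) ℓ
Axiom Tm*  = TmAxiom
Axiom S4m* = S4mAxiom
Axiom S5m* = S5mAxiom

data _⊢⟨_⟩_ {Θ : Signature ℓ} (Γ : Pred (Formula Θ) ℓ) (L : Logic) :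
            Formula Θ → Set ℓ where
  hyp : ∀ {φ} → φ ∈ Γ → Γ ⊢⟨ L ⟩ φ
  ax  : ∀ {φ} → φ ∈ Axiom L → Γ ⊢⟨ L ⟩ φ
  mp  : ∀ {φ ψ} → Γ ⊢⟨ L ⟩ φ → Γ ⊢⟨ L ⟩ φ ⇒ ψ → Γ ⊢⟨ L ⟩ ψ
  gen : ∀ {φ} x → Γ ⊢⟨ L ⟩ φ → Γ ⊢⟨ L ⟩ ∀̇ x φ

{-# OPTIONS --safe #-}

-- Soundness is an induction on derivations. For completeness, gen and Ax4 reduce
-- everything to a sentence ψ that Γ does not derive. Add to the language a witness
-- constant for each variable and formula, in ω stages, together with the Henkin
-- axioms φ[x/c] → ∀xφ; replacing a witness of maximal stage by a fresh variable
-- shows that these axioms are conservative. A Lindenbaum set Δ, maximal among those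
-- not deriving ψ, is then complete and has a counterexample for every underivable
-- universal sentence. The canonical valuation gives φ the value T, t, f, F
-- according to the first of □φ, φ, ◇φ that Δ derives, F if there is none.
-- The propositional modal axioms yield the tables of ¬, □ and →, and the Barcan
-- axioms with the Henkin axioms for □φ, φ and ◇φ yield the minimum for ∀.

module Submission where

open import Defs
open import Level using (Level; Lift; lift; lower)
open import Axiom.ExcludedMiddle using (ExcludedMiddle)
open import Axiom.Extensionality.Propositional using (Extensionality)
open import Data.Bool.Base using (Bool; true; false)
open import Data.Empty using (⊥-elim-irr)
open import Data.Irrelevant as Irrelevant using (Irrelevant)
open import Data.List.Base using (List; []; _∷_; _++_)
open import Data.List.Membership.Propositional using (find; lose) renaming (_∈_ to _∈ᴸ_)
open import Data.List.Relation.Binary.Subset.Propositional using () renaming (_⊆_ to _⊆ᴸ_)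
open import Data.List.Relation.Binary.Subset.Propositional.Properties using (Any-resp-⊆)
open import Data.List.Relation.Unary.All as All using (All; []; _∷_)
import Data.List.Relation.Unary.All.Properties as All
open import Data.List.Relation.Unary.Any using (Any; here; there)
import Data.List.Relation.Unary.Any.Properties as Any
open import Data.Nat.Base as ℕ using (ℕ; zero; suc; _≤_; _<_; z≤n; s≤s)
open import Data.Nat.Properties as ℕ using (_≟_)
open import Data.Product.Base as Prod using (∃; _×_; _,_; proj₁; proj₂)
open import Data.Refinement using (value; Refinement-syntax) renaming (_,_ to _,ʳ_)
open import Data.Sum.Base as Sum using (_⊎_; inj₁; inj₂; [_,_]′)
open import Data.Sum.Properties using (inj₂-injective)
open import Data.Unit.Polymorphic.Base using (⊤; tt)
open import Data.Vec.Base as Vec using (Vec; []; _∷_)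
open import Data.Vec.Membership.Propositional using () renaming (_∈_ to _∈ᵛ_)
import Data.Vec.Properties as Vec
import Data.Vec.Relation.Unary.Any as VecAny
open import Function.Base using (_∘_; id)
open import Function.Bundles using (_⇔_; mk⇔)
open import Relation.Binary.PropositionalEquality as ≡
  using (_≡_; _≢_; refl; sym; trans; cong; cong₂; module ≡-Reasoning)
open import Relation.Nullary
  using (¬_; Dec; does; yes; no; contradiction; ¬?; _×-dec_; _⊎-dec_)
open import Relation.Nullary.Decidable using (map′; recompute; toSum; decidable-stable)
open import Relation.Unary using (Pred; _∈_; _∉_; _⊆_; _∪_; ｛_｝)
open VecAny using (here; there)

-- The tables are nondeterministic, so a valuation cannot be computed by recursion from its atoms;
-- the canonical one is read off from derivability, and every entry of a table is then checked
-- against the axioms. Three obstacles shape the rest. The signature is arbitrary, so formulas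
-- cannot be enumerated: the maximal set comes from a tower closed under unions, and replacing a
-- constant by a variable needs excluded middle to compare constants. Substitution never renames
-- bound variables, so derivations are transported along replacements whose new variables lie beyond
-- a bound; the bound is extracted from the derivation itself, because `mp` and `∼-trans` pass
-- through formulas that the conclusion does not show. The deduction theorem is available for closed
-- hypotheses only, so just sentences are added to reach maximality, while `Γ` may keep open
-- formulas, which act as if universally closed.

module Syntax {ℓ} (Θ : Signature ℓ) where

  -- Simultaneous replacement of constants and free variables

  withConst : Set ℓ → Signature ℓ
  withConst C = record
    { PredSym  = PredSym Θ
    ; somePred = somePred Θ
    ; arity    = arity Θ
    ; arity≥1  = arity≥1 Θ
    ; Const    = C
    }

  For Ter : Set ℓ → Set ℓ
  For C = Formula (withConst C)
  Ter C = Term (withConst C)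

  private
    variable
      C D E : Set ℓ

  var-injective : ∀ {x y} → var {Θ = withConst C} x ≡ var y → x ≡ y
  var-injective refl = refl

  con-injective : ∀ {c d : C} → con {Θ = withConst C} c ≡ con d → c ≡ d
  con-injective refl = refl

  ↦-same : (σ : Subst (withConst C)) (x : Var) {τ : Ter C} → (σ [ x ↦ τ ]) x ≡ τ
  ↦-same σ x with x ≟ x
  ... | yes _  = refl
  ... | no x≢x = contradiction refl x≢x

  ↦-other : (σ : Subst (withConst C)) {x y : Var} {τ : Ter C} →
            y ≢ x → (σ [ x ↦ τ ]) y ≡ σ y
  ↦-other σ {x} {y} y≢x with y ≟ x
  ... | yes y≡x = contradiction y≡x y≢x
  ... | no _    = refl

  -- Simultaneous replacement of constants along ρ and of free variables along
  -- σ; both the embedding into a larger signature and subst are special cases.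
  instTerm : (C → Ter D) → Subst (withConst D) → Ter C → Ter D
  instTerm ρ σ (var x) = σ x
  instTerm ρ σ (con c) = ρ c

  inst : (C → Ter D) → Subst (withConst D) → For C → For D
  inst ρ σ (atom P τs) = atom P (Vec.map (instTerm ρ σ) τs)
  inst ρ σ (¬̇ φ)       = ¬̇ (inst ρ σ φ)
  inst ρ σ (□ φ)       = □ (inst ρ σ φ)
  inst ρ σ (φ ⇒ ψ)     = inst ρ σ φ ⇒ inst ρ σ ψ
  inst ρ σ (∀̇ x φ)     = ∀̇ x (inst ρ (σ [ x ↦ var x ]) φ)

  infix 4 _OccursIn_

  _OccursIn_ : C → For C → Set ℓ
  c OccursIn atom P τs = con c ∈ᵛ τs
  c OccursIn (¬̇ φ)     = c OccursIn φ
  c OccursIn (□ φ)     = c OccursIn φ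
  c OccursIn (φ ⇒ ψ)   = c OccursIn φ ⊎ c OccursIn ψ
  c OccursIn (∀̇ x φ)   = c OccursIn φ

  instTerms-agree : ∀ {n} {ρ ρ′ : C → Ter D} {σ σ′ : Subst (withConst D)}
    (τs : Vec (Ter C) n) →
    (∀ {c} → con c ∈ᵛ τs → ρ c ≡ ρ′ c) →
    (∀ {x} → var x ∈ᵛ τs → σ x ≡ σ′ x) →
    Vec.map (instTerm ρ σ) τs ≡ Vec.map (instTerm ρ′ σ′) τs
  instTerms-agree []           p q = refl
  instTerms-agree (var x ∷ τs) p q =
    cong₂ _∷_ (q (here refl)) (instTerms-agree τs (p ∘ there) (q ∘ there))
  instTerms-agree (con c ∷ τs) p q =
    cong₂ _∷_ (p (here refl)) (instTerms-agree τs (p ∘ there) (q ∘ there))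

  ↦-agree : {σ σ′ : Subst (withConst D)} (φ : For C) {x : Var} {τ : Ter D} →
    (∀ {y} → y FreeIn ∀̇ x φ → σ y ≡ σ′ y) →
    ∀ {y} → y FreeIn φ → (σ [ x ↦ τ ]) y ≡ (σ′ [ x ↦ τ ]) y
  ↦-agree φ {x} q {y} r with y ≟ x
  ... | yes _  = refl
  ... | no y≢x = q (y≢x , r)

  inst-agree : {ρ ρ′ : C → Ter D} {σ σ′ : Subst (withConst D)} (φ : For C) →
    (∀ {c} → c OccursIn φ → ρ c ≡ ρ′ c) →
    (∀ {x} → x FreeIn φ → σ x ≡ σ′ x) →
    inst ρ σ φ ≡ inst ρ′ σ′ φ
  inst-agree (atom P τs) p q = cong (atom P) (instTerms-agree τs p q)
  inst-agree (¬̇ φ)       p q = cong ¬̇_ (inst-agree φ p q)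
  inst-agree (□ φ)       p q = cong □_ (inst-agree φ p q)
  inst-agree (φ ⇒ ψ)     p q = cong₂ _⇒_ (inst-agree φ (p ∘ inj₁) (q ∘ inj₁))
                                         (inst-agree ψ (p ∘ inj₂) (q ∘ inj₂))
  inst-agree (∀̇ x φ)     p q = cong (∀̇ x) (inst-agree φ p (↦-agree φ q))

  instTerms-id : ∀ {n} (τs : Vec (Ter C) n) → Vec.map (instTerm con var) τs ≡ τs
  instTerms-id []           = refl
  instTerms-id (var x ∷ τs) = cong (var x ∷_) (instTerms-id τs)
  instTerms-id (con c ∷ τs) = cong (con c ∷_) (instTerms-id τs)

  ↦-var-id : ∀ (σ : Subst (withConst D)) (φ : For C) {z} →
    (∀ {y} → y FreeIn ∀̇ z φ → σ y ≡ var y) →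
    ∀ {y} → y FreeIn φ → (σ [ z ↦ var z ]) y ≡ var y
  ↦-var-id σ φ {z} eq {y} r with y ≟ z
  ... | yes refl = refl
  ... | no y≢z   = eq (y≢z , r)

  inst-con-var : (φ : For C) → inst con var φ ≡ φ
  inst-con-var (atom P τs) = cong (atom P) (instTerms-id τs)
  inst-con-var (¬̇ φ)       = cong ¬̇_ (inst-con-var φ)
  inst-con-var (□ φ)       = cong □_ (inst-con-var φ)
  inst-con-var (φ ⇒ ψ)     = cong₂ _⇒_ (inst-con-var φ) (inst-con-var ψ)
  inst-con-var (∀̇ x φ)     = cong (∀̇ x) (trans
    (inst-agree φ (λ _ → refl) (↦-var-id var φ (λ _ → refl))) (inst-con-var φ))

  inst-id : {ρ : C → Ter C} {σ : Subst (withConst C)} (φ : For C) →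
    (∀ {c} → c OccursIn φ → ρ c ≡ con c) →
    (∀ {x} → x FreeIn φ → σ x ≡ var x) →
    inst ρ σ φ ≡ φ
  inst-id φ p q = trans (inst-agree φ p q) (inst-con-var φ)

  substTerm≗instTerm : (σ : Subst (withConst C)) (τ : Ter C) →
    substTerm σ τ ≡ instTerm con σ τ
  substTerm≗instTerm σ (var x) = refl
  substTerm≗instTerm σ (con c) = refl

  subst≗inst : (σ : Subst (withConst C)) (φ : For C) → subst σ φ ≡ inst con σ φ
  subst≗inst σ (atom P τs) = cong (atom P) (map-≗ τs)
    where
    map-≗ : ∀ {n} (τs : Vec (Ter _) n) →
            Vec.map (substTerm σ) τs ≡ Vec.map (instTerm con σ) τs
    map-≗ []       = refl
    map-≗ (τ ∷ τs) = cong₂ _∷_ (substTerm≗instTerm σ τ) (map-≗ τs)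
  subst≗inst σ (¬̇ φ)       = cong ¬̇_ (subst≗inst σ φ)
  subst≗inst σ (□ φ)       = cong □_ (subst≗inst σ φ)
  subst≗inst σ (φ ⇒ ψ)     = cong₂ _⇒_ (subst≗inst σ φ) (subst≗inst σ ψ)
  subst≗inst σ (∀̇ x φ)     = cong (∀̇ x) (subst≗inst _ φ)

  free-instTerms : ∀ {n} {ρ : C → Ter D} {σ : Subst (withConst D)}
    (τs : Vec (Ter C) n) {y} → var y ∈ᵛ Vec.map (instTerm ρ σ) τs →
    (∃ λ x → var x ∈ᵛ τs × σ x ≡ var y) ⊎ (∃ λ c → ρ c ≡ var y)
  free-instTerms (var x ∷ τs) (here eq) = inj₁ (x , here refl , sym eq)
  free-instTerms (con c ∷ τs) (here eq) = inj₂ (c , sym eq)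
  free-instTerms (τ ∷ τs) (there p) with free-instTerms τs p
  ... | inj₁ (x , q , eq) = inj₁ (x , there q , eq)
  ... | inj₂ r            = inj₂ r

  -- The second alternative is there because `ρ` may turn a constant into a variable.
  free-inst : {ρ : C → Ter D} {σ : Subst (withConst D)} (φ : For C) {y : Var} →
    y FreeIn inst ρ σ φ →
    (∃ λ x → x FreeIn φ × σ x ≡ var y) ⊎ (∃ λ c → ρ c ≡ var y)
  free-inst (atom P τs) p = free-instTerms τs p
  free-inst (¬̇ φ) p = free-inst φ p
  free-inst (□ φ) p = free-inst φ p
  free-inst (φ ⇒ ψ) (inj₁ p) with free-inst φ p
  ... | inj₁ (x , q , eq) = inj₁ (x , inj₁ q , eq)
  ... | inj₂ r            = inj₂ r
  free-inst (φ ⇒ ψ) (inj₂ p) with free-inst ψ p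
  ... | inj₁ (x , q , eq) = inj₁ (x , inj₂ q , eq)
  ... | inj₂ r            = inj₂ r
  free-inst (∀̇ z φ) (y≢z , p) with free-inst φ p
  ... | inj₂ r = inj₂ r
  ... | inj₁ (x , q , eq) with x ≟ z
  ...   | yes refl = contradiction (sym (var-injective eq)) y≢z
  ...   | no x≢z   = inj₁ (x , (x≢z , q) , eq)

  occurs-instTerms : ∀ {n} {ρ : C → Ter D} {σ : Subst (withConst D)}
    (τs : Vec (Ter C) n) {d} → con d ∈ᵛ Vec.map (instTerm ρ σ) τs →
    (∃ λ c → con c ∈ᵛ τs × ρ c ≡ con d) ⊎ (∃ λ x → σ x ≡ con d)
  occurs-instTerms (var x ∷ τs) (here eq) = inj₂ (x , sym eq)
  occurs-instTerms (con c ∷ τs) (here eq) = inj₁ (c , here refl , sym eq)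
  occurs-instTerms (τ ∷ τs)     (there p) with occurs-instTerms τs p
  ... | inj₁ (c , q , eq) = inj₁ (c , there q , eq)
  ... | inj₂ r            = inj₂ r

  occurs-inst : {ρ : C → Ter D} {σ : Subst (withConst D)} (φ : For C) {d : D} →
    d OccursIn inst ρ σ φ →
    (∃ λ c → c OccursIn φ × ρ c ≡ con d) ⊎ (∃ λ x → σ x ≡ con d)
  occurs-inst (atom P τs) p = occurs-instTerms τs p
  occurs-inst (¬̇ φ) p = occurs-inst φ p
  occurs-inst (□ φ) p = occurs-inst φ p
  occurs-inst (φ ⇒ ψ) (inj₁ p) with occurs-inst φ p
  ... | inj₁ (c , q , eq) = inj₁ (c , inj₁ q , eq)
  ... | inj₂ r            = inj₂ r
  occurs-inst (φ ⇒ ψ) (inj₂ p) with occurs-inst ψ p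
  ... | inj₁ (c , q , eq) = inj₁ (c , inj₂ q , eq)
  ... | inj₂ r            = inj₂ r
  occurs-inst (∀̇ z φ) p with occurs-inst φ p
  ... | inj₁ r = inj₁ r
  ... | inj₂ (x , eq) with x ≟ z | eq
  ...   | yes _ | ()
  ...   | no _  | eq′ = inj₂ (x , eq′)

  -- Constants can become variables, so they are subject to the condition too; it is imposed on all
  -- of them, so that it can be read off from `ρ` without inspecting the formula.
  NoCapture : (C → Ter D) → Subst (withConst D) → For C → Set ℓ
  NoCapture ρ σ (atom P τs) = ⊤
  NoCapture ρ σ (¬̇ φ)       = NoCapture ρ σ φ
  NoCapture ρ σ (□ φ)       = NoCapture ρ σ φ
  NoCapture ρ σ (φ ⇒ ψ)     = NoCapture ρ σ φ × NoCapture ρ σ ψ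
  NoCapture ρ σ (∀̇ z φ)     =
    (∀ c → ρ c ≢ var z) × (∀ {x} → x FreeIn ∀̇ z φ → σ x ≢ var z) ×
    NoCapture ρ (σ [ z ↦ var z ]) φ

  instTerm-↦ : {ρ : D → Ter E} {σ : Subst (withConst E)} {z : Var} {τ′ : Ter E}
    (τ : Ter D) → τ ≢ var z → instTerm ρ (σ [ z ↦ τ′ ]) τ ≡ instTerm ρ σ τ
  instTerm-↦ {σ = σ} (var x) τ≢z = ↦-other σ (λ { refl → τ≢z refl })
  instTerm-↦ (con c) _ = refl

  -- Under a quantifier the outer substitution is reset at the bound variable `z`. This agrees with
  -- the composite because no term put in by the inner replacement is `z` itself.
  inst-inst : {ρ : C → Ter D} {σ : Subst (withConst D)}
    {ρ′ : D → Ter E} {σ′ : Subst (withConst E)} (φ : For C) → NoCapture ρ σ φ →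
    inst ρ′ σ′ (inst ρ σ φ) ≡ inst (instTerm ρ′ σ′ ∘ ρ) (instTerm ρ′ σ′ ∘ σ) φ
  inst-inst {C} {ρ = ρ} {σ} {ρ′} {σ′} (atom P τs) _ = cong (atom P) (map-inst τs)
    where
    map-inst : ∀ {n} (τs : Vec (Ter C) n) →
      Vec.map (instTerm ρ′ σ′) (Vec.map (instTerm ρ σ) τs) ≡
      Vec.map (instTerm (instTerm ρ′ σ′ ∘ ρ) (instTerm ρ′ σ′ ∘ σ)) τs
    map-inst []           = refl
    map-inst (var x ∷ τs) = cong (_ ∷_) (map-inst τs)
    map-inst (con c ∷ τs) = cong (_ ∷_) (map-inst τs)
  inst-inst (¬̇ φ)   nc         = cong ¬̇_ (inst-inst φ nc)
  inst-inst (□ φ)   nc         = cong □_ (inst-inst φ nc)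
  inst-inst (φ ⇒ ψ) (nc , nc′) = cong₂ _⇒_ (inst-inst φ nc) (inst-inst ψ nc′)
  inst-inst {ρ = ρ} {σ} {ρ′} {σ′} (∀̇ z φ) (p , q , nc) = cong (∀̇ z)
    (trans (inst-inst φ nc) (inst-agree φ (λ {c} _ → instTerm-↦ (ρ c) (p c)) agree))
    where
    agree : ∀ {x} → x FreeIn φ →
      instTerm ρ′ (σ′ [ z ↦ var z ]) ((σ [ z ↦ var z ]) x) ≡
      ((instTerm ρ′ σ′ ∘ σ) [ z ↦ var z ]) x
    agree {x} r with x ≟ z
    ... | yes refl = ↦-same σ′ z
    ... | no x≢z   = instTerm-↦ (σ x) (q (x≢z , r))

  -- Bound variables are counted too.
  Below : ℕ → For C → Set ℓ
  Below m (atom P τs) = ∀ {x} → var x ∈ᵛ τs → x < m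
  Below m (¬̇ φ)       = Below m φ
  Below m (□ φ)       = Below m φ
  Below m (φ ⇒ ψ)     = Below m φ × Below m ψ
  Below m (∀̇ x φ)     = x < m × Below m φ

  Below-mono : ∀ {m n} (φ : For C) → m ≤ n → Below m φ → Below n φ
  Below-mono (atom P τs) m≤n b r = ℕ.<-≤-trans (b r) m≤n
  Below-mono (¬̇ φ)       m≤n b = Below-mono φ m≤n b
  Below-mono (□ φ)       m≤n b = Below-mono φ m≤n b
  Below-mono (φ ⇒ ψ)     m≤n (b , b′) = Below-mono φ m≤n b , Below-mono ψ m≤n b′
  Below-mono (∀̇ x φ)     m≤n (x<m , b) = ℕ.<-≤-trans x<m m≤n , Below-mono φ m≤n b

  free-below : ∀ {m x} (φ : For C) → Below m φ → x FreeIn φ → x < m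
  free-below (atom P τs) b r = b r
  free-below (¬̇ φ)   b r = free-below φ b r
  free-below (□ φ)   b r = free-below φ b r
  free-below (φ ⇒ ψ) (b , _) (inj₁ r) = free-below φ b r
  free-below (φ ⇒ ψ) (_ , b) (inj₂ r) = free-below ψ b r
  free-below (∀̇ x φ) (_ , b) (_ , r)  = free-below φ b r

  boundTerm : Ter C → ℕ
  boundTerm (var x) = suc x
  boundTerm (con c) = 0

  boundTerms : ∀ {n} → Vec (Ter C) n → ℕ
  boundTerms []       = 0
  boundTerms (τ ∷ τs) = boundTerm τ ℕ.⊔ boundTerms τs

  bound : For C → ℕ
  bound (atom P τs) = boundTerms τs
  bound (¬̇ φ)       = bound φ
  bound (□ φ)       = bound φ
  bound (φ ⇒ ψ)     = bound φ ℕ.⊔ bound ψ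
  bound (∀̇ x φ)     = suc x ℕ.⊔ bound φ

  terms-below-bound : ∀ {n} (τs : Vec (Ter C) n) {x} → var x ∈ᵛ τs → x < boundTerms τs
  terms-below-bound (τ ∷ τs) (here refl) = ℕ.m≤m⊔n _ (boundTerms τs)
  terms-below-bound (τ ∷ τs) (there p)   =
    ℕ.≤-trans (terms-below-bound τs p) (ℕ.m≤n⊔m (boundTerm τ) _)

  below-bound : (φ : For C) → Below (bound φ) φ
  below-bound (atom P τs) = terms-below-bound τs
  below-bound (¬̇ φ)       = below-bound φ
  below-bound (□ φ)       = below-bound φ
  below-bound (φ ⇒ ψ)     =
    Below-mono φ (ℕ.m≤m⊔n _ _) (below-bound φ) ,
    Below-mono ψ (ℕ.m≤n⊔m (bound φ) _) (below-bound ψ)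
  below-bound (∀̇ x φ)     =
    ℕ.m≤m⊔n (suc x) (bound φ) , Below-mono φ (ℕ.m≤n⊔m (suc x) _) (below-bound φ)

  -- A replacement that leaves a variable in place or introduces one from `m` on cannot be captured
  -- in a formula whose variables lie below `m`. Unlike `NoCapture`, the condition does not mention
  -- the formula, and it survives the passage under a quantifier.
  record Fresh (m : ℕ) (ρ : C → Ter D) (σ : Subst (withConst D)) : Set ℓ where
    field
      con-fresh : ∀ {c z} → ρ c ≡ var z → m ≤ z
      var-fresh : ∀ {x z} → σ x ≡ var z → z ≡ x ⊎ m ≤ z
  open Fresh public

  Fresh-↦ : ∀ {m z} {ρ : C → Ter D} {σ} → Fresh m ρ σ → Fresh m ρ (σ [ z ↦ var z ])
  con-fresh (Fresh-↦ f) = con-fresh f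
  var-fresh (Fresh-↦ {z = z} f) {x} eq with x ≟ z
  ... | yes refl = inj₁ (sym (var-injective eq))
  ... | no _     = var-fresh f eq

  Fresh-≤ : ∀ {m n} {ρ : C → Ter D} {σ} → m ≤ n → Fresh n ρ σ → Fresh m ρ σ
  con-fresh (Fresh-≤ m≤n f) eq = ℕ.≤-trans m≤n (con-fresh f eq)
  var-fresh (Fresh-≤ m≤n f) eq with var-fresh f eq
  ... | inj₁ p = inj₁ p
  ... | inj₂ p = inj₂ (ℕ.≤-trans m≤n p)

  fresh-noCapture : ∀ {m} {ρ : C → Ter D} {σ} (φ : For C) →
    Fresh m ρ σ → Below m φ → NoCapture ρ σ φ
  fresh-noCapture (atom P τs) f b = tt
  fresh-noCapture (¬̇ φ) f b = fresh-noCapture φ f b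
  fresh-noCapture (□ φ) f b = fresh-noCapture φ f b
  fresh-noCapture (φ ⇒ ψ) f (b , b′) = fresh-noCapture φ f b , fresh-noCapture ψ f b′
  fresh-noCapture (∀̇ z φ) f (z<m , b) =
    (λ c eq → ℕ.<⇒≱ z<m (con-fresh f eq)) ,
    (λ { (x≢z , _) eq → [ (λ z≡x → x≢z (sym z≡x)) , ℕ.<⇒≱ z<m ]′ (var-fresh f eq) }) ,
    fresh-noCapture φ (Fresh-↦ f) b

  _freeInTerms?_ : ∀ {n} x (τs : Vec (Ter C) n) → Dec (var x ∈ᵛ τs)
  x freeInTerms? τs = VecAny.any? (λ { (var y) → map′ (cong var) var-injective (x ≟ y)
                                  ; (con c) → no λ () }) τs

  _freeIn?_ : ∀ x (φ : For C) → Dec (x FreeIn φ)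
  x freeIn? atom P τs = x freeInTerms? τs
  x freeIn? (¬̇ φ)     = x freeIn? φ
  x freeIn? (□ φ)     = x freeIn? φ
  x freeIn? (φ ⇒ ψ)   = (x freeIn? φ) ⊎-dec (x freeIn? ψ)
  x freeIn? (∀̇ y φ)   = ¬? (x ≟ y) ×-dec (x freeIn? φ)

  identity-noCapture : (σ : Subst (withConst C)) (φ : For C) →
    (∀ {y} → y FreeIn φ → σ y ≡ var y) → NoCapture con σ φ
  identity-noCapture σ (atom P τs) eq = tt
  identity-noCapture σ (¬̇ φ) eq = identity-noCapture σ φ eq
  identity-noCapture σ (□ φ) eq = identity-noCapture σ φ eq
  identity-noCapture σ (φ ⇒ ψ) eq =
    identity-noCapture σ φ (eq ∘ inj₁) , identity-noCapture σ ψ (eq ∘ inj₂)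
  identity-noCapture σ (∀̇ z φ) eq =
    (λ c ()) ,
    (λ r e → proj₁ r (var-injective (trans (sym (eq r)) e))) ,
    identity-noCapture _ φ (↦-var-id σ φ eq)

  -- `FreeFor` says nothing below a quantifier where `x` is not free, so freeness is decided there,
  -- and in that branch the substitution acts as the identity. Agreement is asked on free variables
  -- only, since `σ` becomes another function under each quantifier.
  freeFor-noCapture : ∀ {x τ} (σ : Subst (withConst C)) (φ : For C) →
    (∀ {y} → y FreeIn φ → σ y ≡ (var [ x ↦ τ ]) y) →
    FreeFor τ x φ → NoCapture con σ φ
  freeFor-noCapture σ (atom P τs) eq ff = tt
  freeFor-noCapture σ (¬̇ φ) eq ff = freeFor-noCapture σ φ eq ff
  freeFor-noCapture σ (□ φ) eq ff = freeFor-noCapture σ φ eq ff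
  freeFor-noCapture σ (φ ⇒ ψ) eq (ff , ff′) =
    freeFor-noCapture σ φ (eq ∘ inj₁) ff , freeFor-noCapture σ ψ (eq ∘ inj₂) ff′
  freeFor-noCapture {x = x} {τ} σ (∀̇ z φ) eq ff with x freeIn? (∀̇ z φ)
  ... | no x∉ = identity-noCapture σ (∀̇ z φ)
    (λ r → trans (eq r) (↦-other var λ { refl → x∉ r }))
  ... | yes x∈@(x≢z , _) = (λ c ()) , avoid , freeFor-noCapture _ φ eq′ (proj₂ (ff x∈))
    where
    avoid : ∀ {y} → y FreeIn ∀̇ z φ → σ y ≢ var z
    avoid {y} r e with y ≟ x | trans (sym e) (eq r)
    ... | yes refl | e′ = proj₁ (ff x∈) (sym e′)
    ... | no y≢x | e′ = proj₁ r (sym (var-injective e′))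
    eq′ : ∀ {y} → y FreeIn φ → (σ [ z ↦ var z ]) y ≡ (var [ x ↦ τ ]) y
    eq′ {y} r with y ≟ z
    ... | yes refl = sym (↦-other var λ z≡x → x≢z (sym z≡x))
    ... | no y≢z   = eq (y≢z , r)

  -- Instances and variants under fresh replacement

  instTerm-fresh-↦ : ∀ {m x} {ρ : C → Ter D} {σ} {τ : Ter D} → Fresh m ρ σ → x < m →
    (∀ c → instTerm con (var [ x ↦ τ ]) (ρ c) ≡ ρ c) ×
    (∀ {w} → w ≢ x → instTerm con (var [ x ↦ τ ]) (σ w) ≡ σ w)
  instTerm-fresh-↦ {m = m} {x} {ρ} {σ} {τ} f x<m = const , vars
    where
    const : ∀ c → instTerm con (var [ x ↦ τ ]) (ρ c) ≡ ρ c
    const c with ρ c in eq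
    ... | con d = refl
    ... | var z = ↦-other var λ { refl → ℕ.<⇒≱ x<m (con-fresh f eq) }
    vars : ∀ {w} → w ≢ x → instTerm con (var [ x ↦ τ ]) (σ w) ≡ σ w
    vars {w} w≢x with σ w in eq
    ... | con d = refl
    ... | var z = ↦-other var λ { refl →
      [ (λ x≡w → w≢x (sym x≡w)) , ℕ.<⇒≱ x<m ]′ (var-fresh f eq) }

  inst-instance : ∀ {ρ : C → Ter D} {σ x} (φ : For C) {τ : Ter C} → FreeFor τ x φ →
    inst ρ σ (φ [ x / τ ]) ≡
    inst ρ (σ [ x ↦ instTerm ρ σ τ ]) φ
  inst-instance {ρ = ρ} {σ} {x} φ {τ} ff = begin
    inst ρ σ (φ [ x / τ ])
      ≡⟨ cong (inst ρ σ) (subst≗inst _ φ) ⟩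
    inst ρ σ (inst con (var [ x ↦ τ ]) φ)
      ≡⟨ inst-inst φ (freeFor-noCapture _ φ (λ _ → refl) ff) ⟩
    inst ρ (instTerm ρ σ ∘ (var [ x ↦ τ ])) φ
      ≡⟨ inst-agree φ (λ _ → refl) (λ {y} _ → agree y) ⟩
    inst ρ (σ [ x ↦ instTerm ρ σ τ ]) φ ∎
    where
    open ≡-Reasoning
    agree : ∀ y → instTerm ρ σ ((var [ x ↦ τ ]) y) ≡ (σ [ x ↦ instTerm ρ σ τ ]) y
    agree y with y ≟ x
    ... | yes _ = refl
    ... | no _  = refl

  -- Counterpart of `inst-instance` for the opposite order. Both bring an instance into the form
  -- `inst ρ (σ [ x ↦ _ ]) φ`, which is how `Ax4` is seen to be stable under replacement.
  instance-inst : ∀ {m x} {ρ : C → Ter D} {σ} (φ : For C) {τ : Ter D} →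
    Fresh m ρ σ → Below m φ → x < m →
    (inst ρ (σ [ x ↦ var x ]) φ) [ x / τ ] ≡ inst ρ (σ [ x ↦ τ ]) φ
  instance-inst {x = x} {ρ} {σ} φ {τ} f b x<m = begin
    (inst ρ (σ [ x ↦ var x ]) φ) [ x / τ ]
      ≡⟨ subst≗inst _ (inst ρ (σ [ x ↦ var x ]) φ) ⟩
    inst con (var [ x ↦ τ ]) (inst ρ (σ [ x ↦ var x ]) φ)
      ≡⟨ inst-inst φ (fresh-noCapture φ (Fresh-↦ f) b) ⟩
    inst (instTerm con (var [ x ↦ τ ]) ∘ ρ)
         (instTerm con (var [ x ↦ τ ]) ∘ (σ [ x ↦ var x ])) φ
      ≡⟨ inst-agree φ (λ {c} _ → proj₁ unaffected c) (λ {y} _ → agree y) ⟩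
    inst ρ (σ [ x ↦ τ ]) φ ∎
    where
    open ≡-Reasoning
    unaffected = instTerm-fresh-↦ {τ = τ} f x<m
    agree : ∀ y → instTerm con (var [ x ↦ τ ]) ((σ [ x ↦ var x ]) y) ≡ (σ [ x ↦ τ ]) y
    agree y with y ≟ x
    ... | yes refl = ↦-same var x
    ... | no y≢x   = proj₂ unaffected y≢x

  free-fresh : ∀ {m x} {ρ : C → Ter D} {σ} (φ : For C) → Fresh m ρ σ → x < m →
    x FreeIn inst ρ σ φ → x FreeIn φ
  free-fresh φ f x<m r with free-inst φ r
  ... | inj₂ (c , eq) = contradiction (con-fresh f eq) (ℕ.<⇒≱ x<m)
  ... | inj₁ (w , r′ , eq) with var-fresh f eq
  ...   | inj₁ refl = r′
  ...   | inj₂ m≤x  = contradiction m≤x (ℕ.<⇒≱ x<m)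

  -- The terms are compared only at variables below `m` because all quantifiers of `φ` bind such
  -- variables.
  freeFor-inst : ∀ {m x τ} {τ′ : Ter D} {ρ : C → Ter D} {σ} (φ : For C) →
    Fresh m ρ σ → Below m φ → x < m →
    (∀ {y} → y < m → τ′ ≡ var y → τ ≡ var y) →
    FreeFor τ x φ → FreeFor τ′ x (inst ρ σ φ)
  freeFor-inst (atom P τs) f b x<m τ′∼τ ff = tt
  freeFor-inst (¬̇ φ) f b x<m τ′∼τ ff = freeFor-inst φ f b x<m τ′∼τ ff
  freeFor-inst (□ φ) f b x<m τ′∼τ ff = freeFor-inst φ f b x<m τ′∼τ ff
  freeFor-inst (φ ⇒ ψ) f (b , b′) x<m τ′∼τ (ff , ff′) =
    freeFor-inst φ f b x<m τ′∼τ ff , freeFor-inst ψ f b′ x<m τ′∼τ ff′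
  freeFor-inst (∀̇ y φ) f (y<m , b) x<m τ′∼τ ff (x≢y , r)
    with ff (x≢y , free-fresh φ (Fresh-↦ f) x<m r)
  ... | τ≢y , ff′ = (λ eq → τ≢y (τ′∼τ y<m eq)) ,
                    freeFor-inst φ (Fresh-↦ f) b x<m τ′∼τ ff′

  instTerm-below : ∀ {m} {ρ : C → Ter D} {σ} (τ : Ter C) → Fresh m ρ σ →
    ∀ {y} → y < m → instTerm ρ σ τ ≡ var y → τ ≡ var y
  instTerm-below (con c) f y<m eq = contradiction (con-fresh f eq) (ℕ.<⇒≱ y<m)
  instTerm-below (var x) f y<m eq with var-fresh f eq
  ... | inj₁ refl = refl
  ... | inj₂ m≤y  = contradiction m≤y (ℕ.<⇒≱ y<m)

  fresh-noFree : ∀ {m} (φ : For C) → Below m φ → ¬ (m FreeIn φ)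
  fresh-noFree φ b r = ℕ.<-irrefl refl (free-below φ b r)

  inst-∀ : ∀ {x} {ρ : C → Ter D} {σ} (γ : For C) {τ : Ter D} → ¬ (x FreeIn γ) →
    inst ρ (σ [ x ↦ τ ]) γ ≡ inst ρ σ γ
  inst-∀ {x = x} {σ = σ} γ x∉γ =
    inst-agree γ (λ _ → refl) (λ r → ↦-other σ λ { refl → x∉γ r })

  -- The bound comes from the proof of `φ ∼ ψ` and not from its endpoints: transitivity goes through
  -- intermediate formulas with bound variables of their own.
  inst-∼ : {φ ψ : For C} → φ ∼ ψ →
    ∃ λ m → ∀ {ρ : C → Ter D} {σ} → Fresh m ρ σ → inst ρ σ φ ∼ inst ρ σ ψ
  inst-∼ ∼-refl = 0 , λ _ → ∼-refl
  inst-∼ (∼-sym p) with inst-∼ p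
  ... | m , h = m , λ f → ∼-sym (h f)
  inst-∼ (∼-trans p q) with inst-∼ p | inst-∼ q
  ... | m , h | n , k = m ℕ.⊔ n , λ f →
    ∼-trans (h (Fresh-≤ (ℕ.m≤m⊔n m n) f)) (k (Fresh-≤ (ℕ.m≤n⊔m m n) f))
  inst-∼ (∼-¬ p) with inst-∼ p
  ... | m , h = m , λ f → ∼-¬ (h f)
  inst-∼ (∼-□ p) with inst-∼ p
  ... | m , h = m , λ f → ∼-□ (h f)
  inst-∼ (∼-⇒ p q) with inst-∼ p | inst-∼ q
  ... | m , h | n , k = m ℕ.⊔ n , λ f →
    ∼-⇒ (h (Fresh-≤ (ℕ.m≤m⊔n m n) f)) (k (Fresh-≤ (ℕ.m≤n⊔m m n) f))
  inst-∼ (∼-∀ p) with inst-∼ p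
  ... | m , h = m , λ f → ∼-∀ (h (Fresh-↦ f))
  inst-∼ {D = D} (void-∀ {x} {γ} x∉γ) = suc x , λ f →
    ≡.subst (λ χ → ∀̇ x (inst _ _ γ) ∼ χ) (inst-∀ γ x∉γ)
      (void-∀ (x∉γ ∘ free-fresh γ (Fresh-↦ f) (ℕ.n<1+n x)))
  inst-∼ (void-∃ {x} {γ} x∉γ) = suc x , λ f →
    ≡.subst (λ χ → ∃̇ x (inst _ _ γ) ∼ χ) (inst-∀ γ x∉γ)
      (void-∃ (x∉γ ∘ free-fresh γ (Fresh-↦ f) (ℕ.n<1+n x)))
  inst-∼ {D = D} (rename {x} {y} {φ} y∉φ ff) = m , renamed
    where
    m = suc x ℕ.⊔ suc y ℕ.⊔ bound φ
    x<m : x < m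
    x<m = ℕ.≤-trans (ℕ.m≤m⊔n _ (suc y)) (ℕ.m≤m⊔n _ (bound φ))
    y<m : y < m
    y<m = ℕ.≤-trans (ℕ.m≤n⊔m (suc x) _) (ℕ.m≤m⊔n _ (bound φ))
    φ<m : Below m φ
    φ<m = Below-mono φ (ℕ.m≤n⊔m (suc x ℕ.⊔ suc y) _) (below-bound φ)
    renamed : ∀ {ρ : _ → Ter D} {σ} → Fresh m ρ σ →
              inst ρ σ (∀̇ x φ) ∼ inst ρ σ (∀̇ y (φ [ x / var y ]))
    renamed {ρ} {σ} f = ≡.subst (λ χ → inst ρ σ (∀̇ x φ) ∼ ∀̇ y χ) (sym body)
      (rename (y∉φ ∘ free-fresh φ (Fresh-↦ f) y<m)
              (freeFor-inst φ (Fresh-↦ f) φ<m x<m (λ { _ refl → refl }) ff))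
      where
      open ≡-Reasoning
      agree : ∀ {w} → w FreeIn φ →
        ((σ [ y ↦ var y ]) [ x ↦ var y ]) w ≡ (σ [ x ↦ var y ]) w
      agree {w} r with w ≟ x
      ... | yes _ = refl
      ... | no _  = ↦-other σ λ { refl → y∉φ r }
      body : inst ρ (σ [ y ↦ var y ]) (φ [ x / var y ]) ≡
             (inst ρ (σ [ x ↦ var x ]) φ) [ x / var y ]
      body = begin
        inst ρ (σ [ y ↦ var y ]) (φ [ x / var y ])
          ≡⟨ inst-instance φ ff ⟩
        inst ρ ((σ [ y ↦ var y ]) [ x ↦ (σ [ y ↦ var y ]) y ]) φ
          ≡⟨ cong (λ τ → inst ρ ((σ [ y ↦ var y ]) [ x ↦ τ ]) φ) (↦-same σ y) ⟩
        inst ρ ((σ [ y ↦ var y ]) [ x ↦ var y ]) φ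
          ≡⟨ inst-agree φ (λ _ → refl) agree ⟩
        inst ρ (σ [ x ↦ var y ]) φ
          ≡⟨ instance-inst φ f φ<m x<m ⟨
        (inst ρ (σ [ x ↦ var x ]) φ) [ x / var y ] ∎

-- Derivations

module Derivation {ℓ} (em : ExcludedMiddle ℓ) (Θ : Signature ℓ) where
  open Syntax Θ

  private
    variable
      L   : Logic
      C D : Set ℓ
      Γ Γ′ : Pred (For C) ℓ
      φ ψ χ : For C

  TmAxiom⇒Axiom : ∀ L → TmAxiom φ → φ ∈ Axiom L
  TmAxiom⇒Axiom Tm*  a = a
  TmAxiom⇒Axiom S4m* a = Tm a
  TmAxiom⇒Axiom S5m* a = S4m (Tm a)

  tm : TmAxiom φ → Γ ⊢⟨ L ⟩ φ
  tm {L = L} a = ax (TmAxiom⇒Axiom L a)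

  mp₂ : Γ ⊢⟨ L ⟩ φ ⇒ ψ ⇒ χ → Γ ⊢⟨ L ⟩ φ → Γ ⊢⟨ L ⟩ ψ → Γ ⊢⟨ L ⟩ χ
  mp₂ d e f = mp f (mp e d)

  weaken : Γ ⊆ Γ′ → Γ ⊢⟨ L ⟩ φ → Γ′ ⊢⟨ L ⟩ φ
  weaken s (hyp p)   = hyp (s p)
  weaken s (ax a)    = ax a
  weaken s (mp d e)  = mp (weaken s d) (weaken s e)
  weaken s (gen x d) = gen x (weaken s d)

  ⇒-refl : Γ ⊢⟨ L ⟩ φ ⇒ φ
  ⇒-refl {φ = φ} = mp₂ (tm (Ax2 φ (φ ⇒ φ) φ)) (tm (Ax1 φ (φ ⇒ φ))) (tm (Ax1 φ φ))

  -- Closedness of `χ` meets the side condition of `Ax5`, which carries the implication past a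
  -- generalisation over any variable.
  deduction : Closed χ → (Γ ∪ ｛ χ ｝) ⊢⟨ L ⟩ φ → Γ ⊢⟨ L ⟩ χ ⇒ φ
  deduction cl (hyp (inj₁ p))    = mp (hyp p) (tm (Ax1 _ _))
  deduction cl (hyp (inj₂ refl)) = ⇒-refl
  deduction cl (ax a)            = mp (ax a) (tm (Ax1 _ _))
  deduction cl (mp d e)          = mp₂ (tm (Ax2 _ _ _)) (deduction cl e) (deduction cl d)
  deduction cl (gen x d)         = mp (gen x (deduction cl d)) (tm (Ax5 x _ _ (cl x)))

  assume : (Γ ∪ ｛ χ ｝) ⊢⟨ L ⟩ χ
  assume = hyp (inj₂ refl)

  drop-hyp : Γ ⊢⟨ L ⟩ φ → (Γ ∪ ｛ χ ｝) ⊢⟨ L ⟩ φ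
  drop-hyp = weaken inj₁

  explosion : Γ ⊢⟨ L ⟩ φ → Γ ⊢⟨ L ⟩ ¬̇ φ → Γ ⊢⟨ L ⟩ ψ
  explosion {φ = φ} {ψ = ψ} d e =
    mp₂ (tm (Ax3 φ ψ)) (mp e (tm (Ax1 _ _))) (mp d (tm (Ax1 _ _)))

  -- Consequentia mirabilis: in `Ax3` with both formulas equal to `φ` the first premise is an
  -- identity.
  reductio : Closed φ → (Γ ∪ ｛ ¬̇ φ ｝) ⊢⟨ L ⟩ φ → Γ ⊢⟨ L ⟩ φ
  reductio {φ = φ} cl d =
    mp₂ (tm (Ax3 φ φ)) ⇒-refl (deduction cl d)

  by-cases : Closed χ → Closed φ →
    (Γ ∪ ｛ χ ｝) ⊢⟨ L ⟩ φ → (Γ ∪ ｛ ¬̇ χ ｝) ⊢⟨ L ⟩ φ → Γ ⊢⟨ L ⟩ φ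
  by-cases clχ clφ d e = reductio clφ
    (mp (reductio clχ (explosion (mp assume (drop-hyp (drop-hyp (deduction clχ e))))
                                 (drop-hyp assume)))
        (drop-hyp (deduction clχ d)))

  -- Only `Ax4`, `Ax5` and `Ax6` have side conditions that a replacement could violate; the other
  -- schemas are stable under every replacement, hence the bound `0`.
  inst-TmAxiom : TmAxiom φ →
    ∃ λ m → ∀ {ρ : C → Ter D} {σ} → Fresh m ρ σ → TmAxiom (inst ρ σ φ)
  inst-TmAxiom (Ax1 φ ψ)   = 0 , λ _ → Ax1 _ _
  inst-TmAxiom (Ax2 φ ψ ξ) = 0 , λ _ → Ax2 _ _ _
  inst-TmAxiom (Ax3 φ ψ)   = 0 , λ _ → Ax3 _ _
  inst-TmAxiom (Ax4 x φ τ ff) = bound (∀̇ x φ) , λ {ρ} {σ} f →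
    let x<m , φ<m = below-bound (∀̇ x φ) in
    ≡.subst (λ χ → TmAxiom (inst ρ σ (∀̇ x φ) ⇒ χ))
      (trans (instance-inst φ f φ<m x<m) (sym (inst-instance φ ff)))
      (Ax4 x _ (instTerm ρ σ τ)
        (freeFor-inst φ (Fresh-↦ f) φ<m x<m (instTerm-below τ f) ff))
  inst-TmAxiom (Ax5 x φ ψ x∉φ) = suc x , λ {ρ} {σ} f →
    ≡.subst (λ χ → TmAxiom (inst ρ σ (∀̇ x (φ ⇒ ψ)) ⇒ χ ⇒ inst ρ σ (∀̇ x ψ)))
      (inst-∀ φ x∉φ)
      (Ax5 x _ _ (x∉φ ∘ free-fresh φ (Fresh-↦ f) (ℕ.n<1+n x)))
  inst-TmAxiom (Ax6 φ ψ φ∼ψ) with inst-∼ φ∼ψ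
  ... | m , h = m , λ f → Ax6 _ _ (h f)
  inst-TmAxiom (K φ ψ)   = 0 , λ _ → K _ _
  inst-TmAxiom (K1 φ ψ)  = 0 , λ _ → K1 _ _
  inst-TmAxiom (K2 φ ψ)  = 0 , λ _ → K2 _ _
  inst-TmAxiom (M1 φ ψ)  = 0 , λ _ → M1 _ _
  inst-TmAxiom (M2 φ ψ)  = 0 , λ _ → M2 _ _
  inst-TmAxiom (M3 φ ψ)  = 0 , λ _ → M3 _ _
  inst-TmAxiom (M4 φ ψ)  = 0 , λ _ → M4 _ _
  inst-TmAxiom (T φ)     = 0 , λ _ → T _
  inst-TmAxiom (DN1 φ)   = 0 , λ _ → DN1 _
  inst-TmAxiom (DN2 φ)   = 0 , λ _ → DN2 _
  inst-TmAxiom (BF x φ)  = 0 , λ _ → BF _ _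
  inst-TmAxiom (CBF x φ) = 0 , λ _ → CBF _ _
  inst-TmAxiom (NBF x φ) = 0 , λ _ → NBF _ _
  inst-TmAxiom (PBF x φ) = 0 , λ _ → PBF _ _

  inst-S4mAxiom : S4mAxiom φ →
    ∃ λ m → ∀ {ρ : C → Ter D} {σ} → Fresh m ρ σ → S4mAxiom (inst ρ σ φ)
  inst-S4mAxiom (Tm a) with inst-TmAxiom a
  ... | m , h = m , Tm ∘ h
  inst-S4mAxiom (four φ) = 0 , λ _ → four _

  inst-Axiom : ∀ L {φ : For C} → φ ∈ Axiom L →
    ∃ λ m → ∀ {ρ : C → Ter D} {σ} → Fresh m ρ σ → inst ρ σ φ ∈ Axiom L
  inst-Axiom Tm*  a = inst-TmAxiom a
  inst-Axiom S4m* a = inst-S4mAxiom a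
  inst-Axiom S5m* (S4m a) with inst-S4mAxiom a
  ... | m , h = m , S4m ∘ h
  inst-Axiom S5m* (five φ) = 0 , λ _ → five _

  -- The bound precedes `ρ`, so that the variable to which constants are sent can be chosen after
  -- inspecting the derivation. Free variables stay fixed because `gen` may bind them later.
  inst-⊢ : {Γ : Pred (For C) ℓ} {Γ′ : Pred (For D) ℓ} → Γ ⊢⟨ L ⟩ φ →
    ∃ λ m → ∀ {ρ : C → Ter D} → Fresh m ρ var →
      (∀ {γ} → γ ∈ Γ → inst ρ var γ ∈ Γ′) → Γ′ ⊢⟨ L ⟩ inst ρ var φ
  inst-⊢ (hyp p) = 0 , λ _ h → hyp (h p)
  inst-⊢ {L = L} (ax a) with inst-Axiom L a
  ... | m , k = m , λ f _ → ax (k f)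
  inst-⊢ (mp d e) with inst-⊢ d | inst-⊢ e
  ... | m , k | n , l = m ℕ.⊔ n , λ f h →
    mp (k (Fresh-≤ (ℕ.m≤m⊔n m n) f) h) (l (Fresh-≤ (ℕ.m≤n⊔m m n) f) h)
  inst-⊢ {Γ′ = Γ′} (gen {φ} x d) with inst-⊢ d
  ... | m , k = m , λ f h → gen x (≡.subst (Γ′ ⊢⟨ _ ⟩_)
    (inst-agree φ (λ _ → refl) (λ r → sym (↦-var-id var φ (λ _ → refl) r))) (k f h))

  fresh-var : ∀ {m y} {ρ : C → Ter D} → (∀ {c z} → ρ c ≡ var z → y ≡ z) →
    m ≤ y → Fresh m ρ var
  con-fresh (fresh-var h m≤y) eq = ≡.subst (_ ≤_) (h eq) m≤y
  var-fresh (fresh-var h m≤y) eq = inj₁ (sym (var-injective eq))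

  ∀-elim : ∀ {x} τ → FreeFor τ x φ → Γ ⊢⟨ L ⟩ ∀̇ x φ → Γ ⊢⟨ L ⟩ φ [ x / τ ]
  ∀-elim τ ff d = mp d (tm (Ax4 _ _ τ ff))

  freeFor-below : ∀ {m x} (φ : For C) → Below m φ → FreeFor (var m) x φ
  freeFor-below (atom P τs) b = tt
  freeFor-below (¬̇ φ)   b = freeFor-below φ b
  freeFor-below (□ φ)   b = freeFor-below φ b
  freeFor-below (φ ⇒ ψ) (b , b′) = freeFor-below φ b , freeFor-below ψ b′
  freeFor-below (∀̇ y φ) (y<m , b) _ =
    (λ { refl → ℕ.<-irrefl refl y<m }) , freeFor-below φ b

  freeFor-con : ∀ {c x} (φ : For C) → FreeFor (con c) x φ
  freeFor-con (atom P τs) = tt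
  freeFor-con (¬̇ φ)   = freeFor-con φ
  freeFor-con (□ φ)   = freeFor-con φ
  freeFor-con (φ ⇒ ψ) = freeFor-con φ , freeFor-con ψ
  freeFor-con (∀̇ y φ) _ = (λ ()) , freeFor-con φ

  freeFor-self : ∀ {x} (φ : For C) → FreeFor (var x) x φ
  freeFor-self (atom P τs) = tt
  freeFor-self (¬̇ φ)   = freeFor-self φ
  freeFor-self (□ φ)   = freeFor-self φ
  freeFor-self (φ ⇒ ψ) = freeFor-self φ , freeFor-self ψ
  freeFor-self (∀̇ y φ) (x≢y , _) = (x≢y ∘ var-injective) , freeFor-self φ

  toVar : C → Var → C → Ter C
  toVar c y d with em {d ≡ c}
  ... | yes _ = var y
  ... | no _  = con d

  toVar-same : ∀ (c : C) y → toVar c y c ≡ var y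
  toVar-same c y with em {c ≡ c}
  ... | yes _  = refl
  ... | no c≢c = contradiction refl c≢c

  toVar-other : ∀ {c d : C} {y} → d ≢ c → toVar c y d ≡ con d
  toVar-other {c = c} {d} d≢c with em {d ≡ c}
  ... | yes eq = contradiction eq d≢c
  ... | no _   = refl

  toVar-fresh : ∀ {m y} {c : C} → m ≤ y → Fresh m (toVar c y) var
  toVar-fresh {y = y} {c} = fresh-var h
    where
    h : ∀ {d z} → toVar c y d ≡ var z → y ≡ z
    h {d} eq with em {d ≡ c}
    h refl | yes _ = refl
    h ()   | no _

  toVar-id : ∀ {c : C} {y} (φ : For C) → ¬ (c OccursIn φ) → inst (toVar c y) var φ ≡ φ
  toVar-id φ c∉φ = inst-id φ (λ r → toVar-other λ { refl → c∉φ r }) (λ _ → refl)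

  -- Since `c` is arbitrary for `Γ`, it can be turned into a fresh variable `y` throughout the
  -- derivation. Generalising over `y` gives a variant of `∀̇ x φ`, and `Ax6` renames it.
  gen-constant : ∀ {x} {c : C} (φ : For C) → ¬ (c OccursIn φ) →
    (∀ {γ} → γ ∈ Γ → ¬ (c OccursIn γ)) →
    Γ ⊢⟨ L ⟩ φ [ x / con c ] → Γ ⊢⟨ L ⟩ ∀̇ x φ
  gen-constant {Γ = Γ} {L = L} {x = x} {c} φ c∉φ c∉Γ d =
    mp (gen y (≡.subst (Γ ⊢⟨ L ⟩_) replaced d′)) (tm (Ax6 _ _ (∼-sym variant)))
    where
    open ≡-Reasoning
    m = proj₁ (inst-⊢ {Γ′ = Γ} d)
    -- Beyond `m` the derivation can be transported; beyond the bound of the formula the side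
    -- conditions of `rename` hold.
    y = m ℕ.⊔ bound (∀̇ x φ)
    ∀φ<y : Below y (∀̇ x φ)
    ∀φ<y = Below-mono (∀̇ x φ) (ℕ.m≤n⊔m m _) (below-bound (∀̇ x φ))
    φ<y : Below y φ
    φ<y = proj₂ ∀φ<y
    variant : ∀̇ x φ ∼ ∀̇ y (φ [ x / var y ])
    variant = rename (fresh-noFree φ φ<y) (freeFor-below φ φ<y)
    d′ : Γ ⊢⟨ L ⟩ inst (toVar c y) var (φ [ x / con c ])
    d′ = proj₂ (inst-⊢ d) (toVar-fresh (ℕ.m≤m⊔n m _))
      (λ {γ} p → ≡.subst (_∈ Γ) (sym (toVar-id γ (c∉Γ p))) p)
    replaced : inst (toVar c y) var (φ [ x / con c ]) ≡ φ [ x / var y ]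
    replaced = begin
      inst (toVar c y) var (φ [ x / con c ])
        ≡⟨ inst-instance φ (freeFor-con φ) ⟩
      inst (toVar c y) (var [ x ↦ toVar c y c ]) φ
        ≡⟨ cong (λ τ → inst (toVar c y) (var [ x ↦ τ ]) φ) (toVar-same c y) ⟩
      inst (toVar c y) (var [ x ↦ var y ]) φ
        ≡⟨ inst-agree φ (λ r → toVar-other λ { refl → c∉φ r }) (λ _ → refl) ⟩
      inst con (var [ x ↦ var y ]) φ
        ≡⟨ subst≗inst _ φ ⟨
      φ [ x / var y ] ∎

  Among : {I : Set ℓ} → (I → For C) → List I → Pred (For C) ℓ
  Among h is φ = Any (λ i → h i ≡ φ) is

  -- Indices rather than formulas are collected, so that the finitely many hypotheses used keep the
  -- witness or sentence they come from. This serves both for Henkin axioms and for members of the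
  -- maximal set.
  compactness : {I : Set ℓ} {P : Pred I ℓ} (h : I → For C) →
    (Γ ∪ (λ φ → ∃ λ i → P i × h i ≡ φ)) ⊢⟨ L ⟩ φ →
    ∃ λ is → All P is × (Γ ∪ Among h is) ⊢⟨ L ⟩ φ
  compactness h (hyp (inj₁ p)) = [] , [] , hyp (inj₁ p)
  compactness h (hyp (inj₂ (i , p , eq))) = i ∷ [] , p ∷ [] , hyp (inj₂ (here eq))
  compactness h (ax a) = [] , [] , ax a
  compactness h (mp d e) with compactness h d | compactness h e
  ... | is , ps , d′ | js , qs , e′ =
    is ++ js , All.++⁺ ps qs ,
    mp (weaken [ inj₁ , inj₂ ∘ Any.++⁺ˡ ]′ d′) (weaken [ inj₁ , inj₂ ∘ Any.++⁺ʳ is ]′ e′)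
  compactness h (gen x d) with compactness h d
  ... | is , ps , d′ = is , ps , gen x d′

  assign : (Var → C) → ℕ → Subst (withConst C)
  assign s n x with x ℕ.<? n
  ... | yes _ = con (s x)
  ... | no _  = var x

  assign-fresh : ∀ {s : Var → C} {n m} → Fresh m con (assign s n)
  con-fresh assign-fresh ()
  var-fresh (assign-fresh {n = n}) {x} eq with x ℕ.<? n
  var-fresh assign-fresh refl | no _ = inj₁ refl

  -- `Ax4` replaces one variable at a time. The terms put in are constants, which later steps leave
  -- untouched, so successive instances add up to a simultaneous one.
  ground-⊢ : ∀ (s : Var → C) n → Γ ⊢⟨ L ⟩ φ → Γ ⊢⟨ L ⟩ inst con (assign s n) φ
  ground-⊢ {Γ = Γ} {φ = φ} s zero d =
    ≡.subst (Γ ⊢⟨ _ ⟩_) (sym (inst-id φ (λ _ → refl) (λ _ → refl))) d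
  ground-⊢ {C} {Γ} {φ = φ} s (suc n) d = ≡.subst (Γ ⊢⟨ _ ⟩_) step
    (∀-elim (con (s n)) (freeFor-con (inst con (assign s n) φ)) (gen n (ground-⊢ s n d)))
    where
    open ≡-Reasoning
    agree : ∀ x → instTerm con (var [ n ↦ con (s n) ]) (assign s n x) ≡ assign s (suc n) x
    agree x with x ℕ.<? n | x ℕ.<? suc n
    ... | yes _   | yes _     = refl
    ... | yes x<n | no x≮1+n  = contradiction (ℕ.m<n⇒m<1+n x<n) x≮1+n
    ... | no x≮n  | yes x<1+n with refl ← ℕ.≤∧≮⇒≡ (ℕ.s≤s⁻¹ x<1+n) x≮n = ↦-same var x
    ... | no _    | no x≮1+n  = ↦-other var λ { refl → x≮1+n (ℕ.n<1+n x) }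
    step : (inst con (assign s n) φ) [ n / con (s n) ] ≡ inst con (assign s (suc n)) φ
    step = begin
      (inst con (assign s n) φ) [ n / con (s n) ]
        ≡⟨ subst≗inst _ (inst con (assign s n) φ) ⟩
      inst con (var [ n ↦ con (s n) ]) (inst con (assign s n) φ)
        ≡⟨ inst-inst φ (fresh-noCapture φ (assign-fresh {s = s} {n}) (below-bound φ)) ⟩
      inst con (instTerm con (var [ n ↦ con (s n) ]) ∘ assign s n) φ
        ≡⟨ inst-agree φ (λ _ → refl) (λ {x} _ → agree x) ⟩
      inst con (assign s (suc n)) φ ∎

  all-instances : ∀ (s : Var → C) → Γ ⊢⟨ L ⟩ φ → Γ ⊢⟨ L ⟩ subst (λ x → con (s x)) φ
  all-instances {Γ = Γ} {φ = φ} s d = ≡.subst (Γ ⊢⟨ _ ⟩_)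
    (trans (inst-agree φ (λ _ → refl) agree) (sym (subst≗inst _ φ)))
    (ground-⊢ s (bound φ) d)
    where
    agree : ∀ {x} → x FreeIn φ → assign s (bound φ) x ≡ con (s x)
    agree {x} r with x ℕ.<? bound φ
    ... | yes _  = refl
    ... | no x≮b = contradiction (free-below φ (below-bound φ) r) x≮b

  closure : ℕ → For C → For C
  closure zero    φ = φ
  closure (suc n) φ = ∀̇ n (closure n φ)

  closure-free : ∀ n (φ : For C) {x} → x FreeIn closure n φ → x FreeIn φ × n ≤ x
  closure-free zero    φ r = r , ℕ.z≤n
  closure-free (suc n) φ (x≢n , r) with closure-free n φ r
  ... | r′ , n≤x = r′ , ℕ.≤∧≢⇒< n≤x (x≢n ∘ sym)

  closure-closed : (φ : For C) → Closed (closure (bound φ) φ)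
  closure-closed φ x r with closure-free (bound φ) φ r
  ... | r′ , b≤x = ℕ.<⇒≱ (free-below φ (below-bound φ) r′) b≤x

  -- `Ax4` with the bound variable itself as the term removes each quantifier.
  closure-elim : ∀ n {φ : For C} → Γ ⊢⟨ L ⟩ closure n φ → Γ ⊢⟨ L ⟩ φ
  closure-elim zero d = d
  closure-elim {Γ = Γ} (suc n) {φ} d = closure-elim n (≡.subst (Γ ⊢⟨ _ ⟩_) self
    (∀-elim (var n) (freeFor-self (closure n φ)) d))
    where
    self : closure n φ [ n / var n ] ≡ closure n φ
    self = trans (subst≗inst _ (closure n φ))
      (inst-id (closure n φ) (λ _ → refl) (↦-var-id var (closure n φ) (λ _ → refl)))

-- The truth tables

pattern isT = inj₁ refl
pattern ist = inj₂ refl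

designated-mono : ∀ {a b} → a ≤ᵗ b → a ∈ Designated → b ∈ Designated
designated-mono {𝐓} {𝐓} le isT = isT
designated-mono {𝐓} {𝐭} (s≤s (s≤s ())) isT
designated-mono {𝐓} {𝐟} (s≤s ()) isT
designated-mono {𝐭} {𝐓} le ist = isT
designated-mono {𝐭} {𝐭} le ist = ist
designated-mono {𝐭} {𝐟} (s≤s ()) ist

𝐓-maximal : ∀ {a b} → a ≡ 𝐓 → a ≤ᵗ b → b ≡ 𝐓
𝐓-maximal {b = 𝐓} _    _ = refl
𝐓-maximal {b = 𝐭} refl (s≤s (s≤s ()))
𝐓-maximal {b = 𝐟} refl (s≤s ())
𝐓-maximal {b = 𝐅} refl ()

𝐅-minimal : ∀ {a b} → b ≡ 𝐅 → a ≤ᵗ b → a ≡ 𝐅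
𝐅-minimal {𝐅} _ _ = refl
𝐅-minimal {𝐓} refl ()
𝐅-minimal {𝐭} refl ()
𝐅-minimal {𝐟} refl ()

𝐟-undesignated : 𝐟 ∉ Designated
𝐟-undesignated (inj₁ ())
𝐟-undesignated (inj₂ ())

𝐅-undesignated : 𝐅 ∉ Designated
𝐅-undesignated (inj₁ ())
𝐅-undesignated (inj₂ ())

𝐓→̃ : ∀ {a} b {c} → a ≡ 𝐓 → c ∈ a →̃ b → c ≡ b
𝐓→̃ 𝐓 refl refl = refl
𝐓→̃ 𝐭 refl refl = refl
𝐓→̃ 𝐟 refl refl = refl
𝐓→̃ 𝐅 refl refl = refl

→̃𝐓 : ∀ a {b c} → b ≡ 𝐓 → c ∈ a →̃ b → c ≡ 𝐓
→̃𝐓 𝐓 refl refl = refl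
→̃𝐓 𝐭 refl refl = refl
→̃𝐓 𝐟 refl refl = refl
→̃𝐓 𝐅 refl refl = refl

𝐅→̃ : ∀ {a} b {c} → a ≡ 𝐅 → c ∈ a →̃ b → c ≡ 𝐓
𝐅→̃ 𝐓 refl refl = refl
𝐅→̃ 𝐭 refl refl = refl
𝐅→̃ 𝐟 refl refl = refl
𝐅→̃ 𝐅 refl refl = refl

𝐓∈→̃𝐅 : ∀ a {b c} → b ≡ 𝐅 → c ≡ 𝐓 → c ∈ a →̃ b → a ≡ 𝐅
𝐓∈→̃𝐅 𝐅 refl refl _ = refl

𝐅∈→̃ : ∀ a b {c} → c ≡ 𝐅 → c ∈ a →̃ b → a ≡ 𝐓 × b ≡ 𝐅
𝐅∈→̃ 𝐓 𝐅 refl _ = refl , refl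
𝐅∈→̃ 𝐭 𝐓 refl ()
𝐅∈→̃ 𝐭 𝐭 refl (inj₁ ())
𝐅∈→̃ 𝐭 𝐭 refl (inj₂ ())
𝐅∈→̃ 𝐟 𝐓 refl ()
𝐅∈→̃ 𝐟 𝐭 refl (inj₁ ())
𝐅∈→̃ 𝐟 𝐭 refl (inj₂ ())
𝐅∈→̃ 𝐟 𝐟 refl (inj₁ ())
𝐅∈→̃ 𝐟 𝐟 refl (inj₂ ())

-- Together with `→̃-intro`: whatever value the table allows, designation of an implication is the
-- classical function of designation of its parts.
→̃-elim : ∀ a b {c} → c ∈ a →̃ b → c ∈ Designated → a ∈ Designated → b ∈ Designated
→̃-elim 𝐓 b p    d _ = ≡.subst Designated (𝐓→̃ b refl p) d
→̃-elim 𝐭 𝐓 p    d _ = isT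
→̃-elim 𝐭 𝐭 p    d _ = ist
→̃-elim 𝐭 𝐟 refl d _ = d
→̃-elim 𝐭 𝐅 refl d _ = contradiction d 𝐟-undesignated
→̃-elim 𝐟 b p    d e = contradiction e 𝐟-undesignated
→̃-elim 𝐅 b p    d e = contradiction e 𝐅-undesignated

→̃-intro : ∀ a b {c} → c ∈ a →̃ b → (a ∈ Designated → b ∈ Designated) → c ∈ Designated
→̃-intro 𝐓 b p    h = ≡.subst Designated (sym (𝐓→̃ b refl p)) (h isT)
→̃-intro 𝐭 𝐓 refl h = isT
→̃-intro 𝐭 𝐭 p    h = p
→̃-intro 𝐭 𝐟 refl h = h ist
→̃-intro 𝐭 𝐅 refl h = contradiction (h ist) 𝐅-undesignated
→̃-intro 𝐟 𝐓 refl h = isT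
→̃-intro 𝐟 𝐭 p    h = p
→̃-intro 𝐟 𝐟 p    h = p
→̃-intro 𝐟 𝐅 refl h = ist
→̃-intro 𝐅 b p    h = inj₁ (sym (𝐅→̃ b refl p))

¬̃-elim : ∀ a {b} → b ∈ ¬̃ a → b ∈ Designated → a ∉ Designated
¬̃-elim 𝐓 refl d e = 𝐅-undesignated d
¬̃-elim 𝐭 refl d e = 𝐟-undesignated d
¬̃-elim 𝐟 refl d e = 𝐟-undesignated e
¬̃-elim 𝐅 refl d e = 𝐅-undesignated e

¬̃-intro : ∀ a {b} → b ∈ ¬̃ a → a ∉ Designated → b ∈ Designated
¬̃-intro 𝐓 refl h = contradiction isT h
¬̃-intro 𝐭 refl h = contradiction ist h
¬̃-intro 𝐟 refl h = ist
¬̃-intro 𝐅 refl h = isT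

¬̃-dual : ∀ a {b} → b ∈ ¬̃ a → b ≡ 𝐓 → a ≡ 𝐅
¬̃-dual 𝐅 p refl = refl

¬̃𝐅 : ∀ {a b} → a ≡ 𝐅 → b ∈ ¬̃ a → b ≡ 𝐓
¬̃𝐅 refl refl = refl

¬̃𝐓 : ∀ {a b} → a ≡ 𝐓 → b ∈ ¬̃ a → b ≡ 𝐅
¬̃𝐓 refl refl = refl

¬̃-involutive : ∀ a {b c} → b ∈ ¬̃ a → c ∈ ¬̃ b → c ≡ a
¬̃-involutive 𝐓 refl refl = refl
¬̃-involutive 𝐭 refl refl = refl
¬̃-involutive 𝐟 refl refl = refl
¬̃-involutive 𝐅 refl refl = refl

-- Together with `□̃-elim`: in all three tables `□` is designated exactly at 𝐓. The logics differ
-- only in which designated or undesignated value is taken.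
□̃-intro : ∀ L {a b} → a ≡ 𝐓 → b ∈ □̃ L a → b ∈ Designated
□̃-intro Tm*  refl p    = p
□̃-intro S4m* refl refl = isT
□̃-intro S5m* refl refl = isT

f∪F-undesignated : ∀ {b} → (｛ 𝐟 ｝ ∪ ｛ 𝐅 ｝) b → b ∉ Designated
f∪F-undesignated (inj₁ refl) = 𝐟-undesignated
f∪F-undesignated (inj₂ refl) = 𝐅-undesignated

□̃-elim : ∀ L a {b} → b ∈ □̃ L a → b ∈ Designated → a ≡ 𝐓
□̃-elim L    𝐓 p d = refl
□̃-elim Tm*  𝐭 p d = contradiction d (f∪F-undesignated p)
□̃-elim Tm*  𝐟 p d = contradiction d (f∪F-undesignated p)
□̃-elim Tm*  𝐅 p d = contradiction d (f∪F-undesignated p)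
□̃-elim S4m* 𝐭 p d = contradiction d (f∪F-undesignated p)
□̃-elim S4m* 𝐟 p d = contradiction d (f∪F-undesignated p)
□̃-elim S4m* 𝐅 p d = contradiction d (f∪F-undesignated p)
□̃-elim S5m* 𝐭 refl d = contradiction d 𝐅-undesignated
□̃-elim S5m* 𝐟 refl d = contradiction d 𝐅-undesignated
□̃-elim S5m* 𝐅 refl d = contradiction d 𝐅-undesignated

□̃-𝐓 : ∀ {L a b} → L ≢ Tm* → a ≡ 𝐓 → b ∈ □̃ L a → b ≡ 𝐓
□̃-𝐓 {Tm*}  L≢Tm _    _    = contradiction refl L≢Tm
□̃-𝐓 {S4m*} _    refl refl = refl
□̃-𝐓 {S5m*} _    refl refl = refl

□̃₃-elim : ∀ a {b} → b ∈ □̃₃ a → b ≢ 𝐅 → a ≡ 𝐓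
□̃₃-elim 𝐓 p    h = refl
□̃₃-elim 𝐭 refl h = contradiction refl h
□̃₃-elim 𝐟 refl h = contradiction refl h
□̃₃-elim 𝐅 refl h = contradiction refl h

-- Soundness

module Embedding {ℓ} {Θ : Signature ℓ} (𝔄 : Structure Θ) where
  open Syntax Θ

  subst-embed : (σ : Subst (diagramSig 𝔄)) (φ : Formula Θ) →
    subst σ (embed 𝔄 φ) ≡ inst (con ∘ inj₁) σ φ
  subst-embed σ (atom P τs) = cong (atom P) (map-embed τs)
    where
    map-embed : ∀ {n} (τs : Vec (Term Θ) n) →
      Vec.map (substTerm σ) (Vec.map (embedTerm 𝔄) τs) ≡
      Vec.map (instTerm (con ∘ inj₁) σ) τs
    map-embed []           = refl
    map-embed (var x ∷ τs) = cong (_ ∷_) (map-embed τs)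
    map-embed (con c ∷ τs) = cong (_ ∷_) (map-embed τs)
  subst-embed σ (¬̇ φ)       = cong ¬̇_ (subst-embed σ φ)
  subst-embed σ (□ φ)       = cong □_ (subst-embed σ φ)
  subst-embed σ (φ ⇒ ψ)     = cong₂ _⇒_ (subst-embed σ φ) (subst-embed σ ψ)
  subst-embed σ (∀̇ x φ)     = cong (∀̇ x) (subst-embed _ φ)

module Soundness {ℓ} (em : ExcludedMiddle ℓ) {L : Logic} {Θ : Signature ℓ}
                 (𝔄 : Structure Θ) (V : Valuation L 𝔄) where
  open Syntax Θ
  open Embedding 𝔄
  open Valuation V
  open ≡-Reasoning

  C⁺ : Set ℓ
  C⁺ = Const Θ ⊎ Ū 𝔄

  infixl 40 _⟨_≔_⟩

  _⟨_≔_⟩ : (Var → C⁺) → Var → C⁺ → Var → C⁺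
  (s ⟨ x ≔ c ⟩) y with y ≟ x
  ... | yes _ = c
  ... | no _  = s y

  con-≔ : ∀ s x c y → (_[_↦_] {Θ = withConst C⁺} (con ∘ s) x (con c)) y ≡ con ((s ⟨ x ≔ c ⟩) y)
  con-≔ s x c y with y ≟ x
  ... | yes _ = refl
  ... | no _  = refl

  ground : (Var → C⁺) → For (Const Θ) → For C⁺
  ground s = inst (con ∘ inj₁) (con ∘ s)

  ground-fresh : ∀ {m} (s : Var → C⁺) → Fresh {C = Const Θ} m (con ∘ inj₁) (con ∘ s)
  con-fresh (ground-fresh s) ()
  var-fresh (ground-fresh s) ()

  -- Proofs of closedness are irrelevant, so sentences with the same underlying formula are equal.
  v-cong : ∀ {a b : Sen (diagramSig 𝔄)} → value a ≡ value b → v a ≡ v b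
  v-cong refl = refl

  ⟦_⟧ : Formula Θ → (Var → C⁺) → TV
  ⟦ φ ⟧ s = v (groundˢ s (embed 𝔄 φ))

  ⟦⟧-cong : ∀ φ ψ {s t} → ground s φ ≡ ground t ψ → ⟦ φ ⟧ s ≡ ⟦ ψ ⟧ t
  ⟦⟧-cong φ ψ eq = v-cong (trans (subst-embed _ φ) (trans eq (sym (subst-embed _ ψ))))

  ⟦instance⟧ : ∀ {x} φ {τ : Term Θ} {c s} → FreeFor τ x φ →
    instTerm (con ∘ inj₁) (con ∘ s) τ ≡ con c → ⟦ φ [ x / τ ] ⟧ s ≡ ⟦ φ ⟧ (s ⟨ x ≔ c ⟩)
  ⟦instance⟧ {x} φ {τ} {c} {s} ff eq = ⟦⟧-cong (φ [ x / τ ]) φ (begin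
    ground s (φ [ x / τ ])
      ≡⟨ inst-instance φ ff ⟩
    inst (con ∘ inj₁) ((con ∘ s) [ x ↦ instTerm (con ∘ inj₁) (con ∘ s) τ ]) φ
      ≡⟨ cong (λ τ′ → inst (con ∘ inj₁) ((con ∘ s) [ x ↦ τ′ ]) φ) eq ⟩
    inst (con ∘ inj₁) ((con ∘ s) [ x ↦ con c ]) φ
      ≡⟨ inst-agree φ (λ _ → refl) (λ {y} _ → con-≔ s x c y) ⟩
    ground (s ⟨ x ≔ c ⟩) φ ∎)

  ⟦∀⟧ : ∀ x φ s → ⟦ ∀̇ x φ ⟧ s ∈ ∀̃ (λ a → ∃ λ c → ⟦ φ ⟧ (s ⟨ x ≔ c ⟩) ≡ a)
  ⟦∀⟧ x φ s with v-∀ x _ (Irrelevant.pure (closed-ground s (embed 𝔄 (∀̇ x φ))))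
  ... | (c , attained) , below =
    (c , trans (sym (v-instance c)) attained) ,
    λ { (c′ , eq) → below (c′ , trans (v-instance c′) eq) }
    where
    closed = Irrelevant.pure (closed-ground s (embed 𝔄 (∀̇ x φ)))
    v-instance : ∀ c →
      v (instanceˢ x (subst ((con ∘ s) [ x ↦ var x ]) (embed 𝔄 φ)) closed c) ≡
      ⟦ φ ⟧ (s ⟨ x ≔ c ⟩)
    v-instance c = v-cong (begin
      (subst ((con ∘ s) [ x ↦ var x ]) (embed 𝔄 φ)) [ x / con c ]
        ≡⟨ cong (_[ x / con c ]) (subst-embed _ φ) ⟩
      (inst (con ∘ inj₁) ((con ∘ s) [ x ↦ var x ]) φ) [ x / con c ]
        ≡⟨ instance-inst φ (ground-fresh s) (proj₂ (below-bound (∀̇ x φ)))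
                           (proj₁ (below-bound (∀̇ x φ))) ⟩
      inst (con ∘ inj₁) ((con ∘ s) [ x ↦ con c ]) φ
        ≡⟨ inst-agree φ (λ _ → refl) (λ {y} _ → con-≔ s x c y) ⟩
      ground (s ⟨ x ≔ c ⟩) φ
        ≡⟨ subst-embed _ φ ⟨
      subst (con ∘ (s ⟨ x ≔ c ⟩)) (embed 𝔄 φ) ∎)

  infix 4 _⊩_

  _⊩_ : (Var → C⁺) → Formula Θ → Set
  s ⊩ φ = ⟦ φ ⟧ s ∈ Designated

  ⟦¬⟧ : ∀ φ s → ⟦ ¬̇ φ ⟧ s ∈ ¬̃ (⟦ φ ⟧ s)
  ⟦¬⟧ φ s = v-¬ (groundˢ s (embed 𝔄 φ))

  ⟦□⟧ : ∀ φ s → ⟦ □ φ ⟧ s ∈ □̃ L (⟦ φ ⟧ s)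
  ⟦□⟧ φ s = v-□ (groundˢ s (embed 𝔄 φ))

  ⟦⇒⟧ : ∀ φ ψ s → ⟦ φ ⇒ ψ ⟧ s ∈ (⟦ φ ⟧ s →̃ ⟦ ψ ⟧ s)
  ⟦⇒⟧ φ ψ s = v-⇒ (groundˢ s (embed 𝔄 φ)) (groundˢ s (embed 𝔄 ψ))

  module _ {s : Var → C⁺} where

    ⇒-elim : ∀ {φ ψ} → s ⊩ φ ⇒ ψ → s ⊩ φ → s ⊩ ψ
    ⇒-elim {φ} {ψ} = →̃-elim _ _ (⟦⇒⟧ φ ψ s)

    ⇒-intro : ∀ {φ ψ} → (s ⊩ φ → s ⊩ ψ) → s ⊩ φ ⇒ ψ
    ⇒-intro {φ} {ψ} = →̃-intro _ _ (⟦⇒⟧ φ ψ s)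

    ¬-elim : ∀ {φ} → s ⊩ ¬̇ φ → ¬ s ⊩ φ
    ¬-elim {φ} = ¬̃-elim _ (⟦¬⟧ φ s)

    ¬-intro : ∀ {φ} → ¬ s ⊩ φ → s ⊩ ¬̇ φ
    ¬-intro {φ} = ¬̃-intro _ (⟦¬⟧ φ s)

    □-elim : ∀ {φ} → s ⊩ □ φ → ⟦ φ ⟧ s ≡ 𝐓
    □-elim {φ} = □̃-elim L _ (⟦□⟧ φ s)

    □-intro : ∀ {φ} → ⟦ φ ⟧ s ≡ 𝐓 → s ⊩ □ φ
    □-intro {φ} eq = □̃-intro L eq (⟦□⟧ φ s)

    □¬-elim : ∀ {φ} → s ⊩ □ (¬̇ φ) → ⟦ φ ⟧ s ≡ 𝐅
    □¬-elim {φ} d = ¬̃-dual _ (⟦¬⟧ φ s) (□-elim d)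

    □¬-intro : ∀ {φ} → ⟦ φ ⟧ s ≡ 𝐅 → s ⊩ □ (¬̇ φ)
    □¬-intro {φ} eq = □-intro (¬̃𝐅 eq (⟦¬⟧ φ s))

    ◇-elim : ∀ {φ} → s ⊩ ◇ φ → ⟦ φ ⟧ s ≢ 𝐅
    ◇-elim d eq = ¬-elim d (□¬-intro eq)

    ◇-intro : ∀ {φ} → ⟦ φ ⟧ s ≢ 𝐅 → s ⊩ ◇ φ
    ◇-intro h = ¬-intro λ d → h (□¬-elim d)

    ⊩-stable : ∀ {φ} → (¬ s ⊩ φ → s ⊩ φ) → s ⊩ φ
    ⊩-stable {φ} h with ⟦ φ ⟧ s
    ... | 𝐓 = isT
    ... | 𝐭 = ist
    ... | 𝐟 = h 𝐟-undesignated
    ... | 𝐅 = h 𝐅-undesignated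

  ∀-≤ : ∀ {x φ s} c → ⟦ ∀̇ x φ ⟧ s ≤ᵗ ⟦ φ ⟧ (s ⟨ x ≔ c ⟩)
  ∀-≤ {x} {φ} {s} c = proj₂ (⟦∀⟧ x φ s) (c , refl)

  -- The minimum is attained at some instance, so a property shared by all instances passes to the
  -- quantified formula, whether or not it is monotone.
  ∀-intro : ∀ {p x φ s} (P : TV → Set p) → (∀ c → P (⟦ φ ⟧ (s ⟨ x ≔ c ⟩))) → P (⟦ ∀̇ x φ ⟧ s)
  ∀-intro {x = x} {φ} {s} P h with ⟦∀⟧ x φ s
  ... | (c , eq) , _ = ≡.subst P eq (h c)

  ⊩-∀-elim : ∀ {x φ s} → s ⊩ ∀̇ x φ → ∀ c → s ⟨ x ≔ c ⟩ ⊩ φ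
  ⊩-∀-elim {φ = φ} d c = designated-mono (∀-≤ {φ = φ} c) d

  ≔-irrelevant : ∀ {x s c} φ → ¬ (x FreeIn φ) → ⟦ φ ⟧ (s ⟨ x ≔ c ⟩) ≡ ⟦ φ ⟧ s
  ≔-irrelevant {x} {s} {c} φ x∉φ = ⟦⟧-cong φ φ (inst-agree φ (λ _ → refl) agree)
    where
    agree : ∀ {y} → y FreeIn φ → con {Θ = withConst C⁺} ((s ⟨ x ≔ c ⟩) y) ≡ con (s y)
    agree {y} r with y ≟ x
    ... | yes refl = contradiction r x∉φ
    ... | no _     = refl

  closed-term : ∀ (s : Var → C⁺) (τ : Term Θ) →
    ∃ λ c → instTerm (con ∘ inj₁) (con ∘ s) τ ≡ con c
  closed-term s (var x) = s x , refl
  closed-term s (con c) = inj₁ c , refl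

  -- Designation of `□ φ` says that `φ` has value 𝐓, designation of `◇ φ` that its value is not 𝐅.
  -- Read this way, the propositional modal axioms state entries of the tables and the Barcan axioms
  -- state properties of a minimum.
  sound-Tm : ∀ {φ} → TmAxiom φ → ∀ s → s ⊩ φ
  sound-Tm (Ax1 φ ψ) s = ⇒-intro λ d → ⇒-intro λ _ → d
  sound-Tm (Ax2 φ ψ ξ) s = ⇒-intro λ d → ⇒-intro λ e → ⇒-intro λ p →
    ⇒-elim (⇒-elim d p) (⇒-elim e p)
  sound-Tm (Ax3 φ ψ) s = ⇒-intro λ d → ⇒-intro λ e → ⊩-stable λ h →
    contradiction (⇒-elim e (¬-intro h)) (¬-elim (⇒-elim d (¬-intro h)))
  sound-Tm (Ax4 x φ τ ff) s with closed-term s τ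
  ... | c , eq = ⇒-intro λ d →
    ≡.subst Designated (sym (⟦instance⟧ φ ff eq)) (⊩-∀-elim {φ = φ} d c)
  sound-Tm (Ax5 x φ ψ x∉φ) s = ⇒-intro λ d → ⇒-intro λ e → ∀-intro {φ = ψ} Designated λ c →
    ⇒-elim (⊩-∀-elim {φ = φ ⇒ ψ} d c) (≡.subst Designated (sym (≔-irrelevant φ x∉φ)) e)
  sound-Tm (Ax6 φ ψ φ∼ψ) s = ⇒-intro (≡.subst Designated (v-∼ variant))
    where
    variant : subst (con ∘ s) (embed 𝔄 φ) ∼ subst (con ∘ s) (embed 𝔄 ψ)
    variant = ≡.subst₂ _∼_ (sym (subst-embed _ φ)) (sym (subst-embed _ ψ))
      (proj₂ (inst-∼ φ∼ψ) (ground-fresh s))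
  sound-Tm (K φ ψ) s = ⇒-intro λ d → ⇒-intro λ e → □-intro
    (trans (sym (𝐓→̃ _ (□-elim {φ = φ} e) (⟦⇒⟧ φ ψ s))) (□-elim {φ = φ ⇒ ψ} d))
  sound-Tm (K1 φ ψ) s = ⇒-intro λ d → ⇒-intro λ e → □¬-intro
    (𝐓∈→̃𝐅 _ (□¬-elim {φ = ψ} e) (□-elim {φ = φ ⇒ ψ} d) (⟦⇒⟧ φ ψ s))
  sound-Tm (K2 φ ψ) s = ⇒-intro λ d → ⇒-intro λ e → ◇-intro λ eq →
    ◇-elim {φ = φ ⇒ ψ} d (trans (𝐓→̃ _ (□-elim {φ = φ} e) (⟦⇒⟧ φ ψ s)) eq)
  sound-Tm (M1 φ ψ) s = ⇒-intro λ d → □-intro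
    (𝐅→̃ (⟦ ψ ⟧ s) (□¬-elim {φ = φ} d) (⟦⇒⟧ φ ψ s))
  sound-Tm (M2 φ ψ) s = ⇒-intro λ d → □-intro
    (→̃𝐓 (⟦ φ ⟧ s) (□-elim {φ = ψ} d) (⟦⇒⟧ φ ψ s))
  sound-Tm (M3 φ ψ) s = ⇒-intro λ d → ◇-intro λ eq → ◇-elim {φ = ψ} d
    (proj₂ (𝐅∈→̃ (⟦ φ ⟧ s) (⟦ ψ ⟧ s) eq (⟦⇒⟧ φ ψ s)))
  sound-Tm (M4 φ ψ) s = ⇒-intro λ d → ◇-intro λ eq → ◇-elim {φ = ¬̇ φ} d
    (¬̃𝐓 (proj₁ (𝐅∈→̃ (⟦ φ ⟧ s) (⟦ ψ ⟧ s) eq (⟦⇒⟧ φ ψ s))) (⟦¬⟧ φ s))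
  sound-Tm (T φ) s = ⇒-intro λ d → inj₁ (sym (□-elim d))
  sound-Tm (DN1 φ) s = ⇒-intro λ d → □-intro
    (trans (¬̃-involutive _ (⟦¬⟧ φ s) (⟦¬⟧ (¬̇ φ) s)) (□-elim d))
  sound-Tm (DN2 φ) s = ⇒-intro λ d → □-intro
    (trans (sym (¬̃-involutive _ (⟦¬⟧ φ s) (⟦¬⟧ (¬̇ φ) s))) (□-elim d))
  sound-Tm (BF x φ) s = ⇒-intro λ d → □-intro
    (∀-intro {φ = φ} (_≡ 𝐓) λ c → □-elim {φ = φ} (⊩-∀-elim {φ = □ φ} d c))
  sound-Tm (CBF x φ) s = ⇒-intro λ d → ∀-intro {φ = □ φ} Designated λ c → □-intro
    (𝐓-maximal (□-elim {φ = ∀̇ x φ} d) (∀-≤ {φ = φ} c))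
  sound-Tm (NBF x φ) s = ⇒-intro λ d → ◇-intro
    (∀-intro {φ = φ} (_≢ 𝐅) λ c → ◇-elim {φ = φ} (⊩-∀-elim {φ = ◇ φ} d c))
  sound-Tm (PBF x φ) s = ⇒-intro λ d → ∀-intro {φ = ◇ φ} Designated λ c →
    ◇-intro λ eq →
    ◇-elim {φ = ∀̇ x φ} d (𝐅-minimal eq (∀-≤ {φ = φ} c))

  sound-S4m : ∀ {φ} → L ≢ Tm* → S4mAxiom φ → ∀ s → s ⊩ φ
  sound-S4m L≢Tm (Tm a) s = sound-Tm a s
  sound-S4m L≢Tm (four φ) s = ⇒-intro λ d → □-intro
    (□̃-𝐓 L≢Tm (□-elim {φ = φ} d) (⟦□⟧ φ s))

  -- The logic is tied to the valuation as a module parameter; the case split is on a copy linked to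
  -- it by an equation.
  sound-Axiom : ∀ L′ → L ≡ L′ → ∀ {φ : Formula Θ} → φ ∈ Axiom L′ → ∀ s → s ⊩ φ
  sound-Axiom Tm*  _    a        s = sound-Tm a s
  sound-Axiom S4m* refl a        s = sound-S4m (λ ()) a s
  sound-Axiom S5m* refl (S4m a)  s = sound-S4m (λ ()) a s
  sound-Axiom S5m* refl (five φ) s = ⇒-intro λ d → □-intro
    (□̃₃-elim _ (⟦□⟧ φ s) (◇-elim {φ = □ φ} d))

  gen-sound : ∀ {x φ} → (∀ s → s ⊩ φ) → ∀ s → s ⊩ ∀̇ x φ
  gen-sound {φ = φ} h s = ∀-intro {φ = φ} Designated λ c → h _

  sound : ∀ {Γ : Pred (Formula Θ) ℓ} {φ} → (∀ {γ} → γ ∈ Γ → ∀ s → s ⊩ γ) →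
    Γ ⊢⟨ L ⟩ φ → ∀ s → s ⊩ φ
  sound h (hyp p)   s = h p s
  sound h (ax a)    s = sound-Axiom L refl a s
  sound h (mp d e)  s = ⇒-elim (sound h e s) (sound h d s)
  sound h (gen {φ} x d) s = gen-sound {φ = φ} (sound h d) s

-- Sets are Bool-valued, so that with excluded middle the powerset stays in the
-- universe of A; the maximal set is the union of the tower generated by adding
-- one element at a time. The element is chosen by excluded middle, which holds
-- for all types and so acts as a choice function.
module Lindenbaum {ℓ} (em : ExcludedMiddle ℓ) (ext : Extensionality ℓ Level.zero)
  {A : Set ℓ} (Bad : List A → Set ℓ) (bad-mono : ∀ {xs ys} → xs ⊆ᴸ ys → Bad xs → Bad ys)
  (good-[] : ¬ Bad []) where

  -- Maximal good sets

  𝒫 : Set ℓ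
  𝒫 = A → Bool

  infix 4 _∈ᴮ_ _⊆ᴮ_

  _∈ᴮ_ : A → 𝒫 → Set
  a ∈ᴮ X = X a ≡ true

  _⊆ᴮ_ : 𝒫 → 𝒫 → Set ℓ
  X ⊆ᴮ Y = ∀ {a} → a ∈ᴮ X → a ∈ᴮ Y

  -- Since `next` chooses its element, mutual inclusion of two sets does not by itself relate their
  -- successors; equality does, and this is what extensionality is for.
  ⊆-antisym : ∀ X Y → X ⊆ᴮ Y → Y ⊆ᴮ X → X ≡ Y
  ⊆-antisym X Y p q = ext λ a → eq a
    where
    eq : ∀ a → X a ≡ Y a
    eq a with X a in x | Y a in y
    ... | true  | true  = refl
    ... | false | false = refl
    ... | true  | false = trans (sym (p x)) y
    ... | false | true  = trans (sym x) (q y)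

  comprehend : (A → Set ℓ) → 𝒫
  comprehend P a = does (em {P a})

  ∈-comprehend⁺ : ∀ P {a} → P a → a ∈ᴮ comprehend P
  ∈-comprehend⁺ P {a} p with em {P a}
  ... | yes _ = refl
  ... | no ¬p = contradiction p ¬p

  ∈-comprehend⁻ : ∀ P {a} → a ∈ᴮ comprehend P → P a
  ∈-comprehend⁻ P {a} _ with em {P a}
  ∈-comprehend⁻ P _ | yes p = p

  Good : 𝒫 → Set ℓ
  Good X = ∀ xs → All (_∈ᴮ X) xs → ¬ Bad xs

  Insert : A → 𝒫 → A → Set ℓ
  Insert a X b = b ≡ a ⊎ b ∈ᴮ X

  insert : A → 𝒫 → 𝒫
  insert a X = comprehend (Insert a X)

  Addable : 𝒫 → A → Set ℓ
  Addable X a = ¬ (a ∈ᴮ X) × Good (insert a X)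

  next : 𝒫 → 𝒫
  next X with em {∃ (Addable X)}
  ... | yes (a , _) = insert a X
  ... | no _        = X

  next-extensive : ∀ X → X ⊆ᴮ next X
  next-extensive X b∈X with em {∃ (Addable X)}
  ... | yes (a , _) = ∈-comprehend⁺ (Insert a X) (inj₂ b∈X)
  ... | no _        = b∈X

  next-good : ∀ X → Good X → Good (next X)
  next-good X g with em {∃ (Addable X)}
  ... | yes (a , _ , g′) = g′
  ... | no _             = g

  next-new : ∀ X {a} → Addable X a → ∃ λ b → ¬ (b ∈ᴮ X) × b ∈ᴮ next X
  next-new X {a} add with em {∃ (Addable X)}
  ... | yes (b , b∉X , _) = b , b∉X , ∈-comprehend⁺ (Insert b X) (inj₁ refl)
  ... | no none           = contradiction (a , add) none

  Union : (𝒫 → Bool) → A → Set ℓ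
  Union C a = ∃ λ X → C X ≡ true × a ∈ᴮ X

  ⋃ : (𝒫 → Bool) → 𝒫
  ⋃ C = comprehend (Union C)

  -- A starting point is included: the union of the empty family is the empty set.
  data Tower : 𝒫 → Set ℓ where
    next-tower : ∀ {X} → Tower X → Tower (next X)
    ⋃-tower    : ∀ C → (∀ {X} → C X ≡ true → Tower X) → Tower (⋃ C)

  ⋃-upper : ∀ C {X} → C X ≡ true → X ⊆ᴮ ⋃ C
  ⋃-upper C CX a∈X = ∈-comprehend⁺ (Union C) (_ , CX , a∈X)

  ⋃-least : ∀ C {Y} → (∀ {X} → C X ≡ true → X ⊆ᴮ Y) → ⋃ C ⊆ᴮ Y
  ⋃-least C h r with ∈-comprehend⁻ (Union C) r
  ... | X , CX , a∈X = h CX a∈X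

  -- As in the Bourbaki–Witt theorem, every element of the tower turns out to be
  -- extreme and extreme elements are comparable with the whole tower.
  Extreme : 𝒫 → Set ℓ
  Extreme X = ∀ {Y} → Tower Y → Y ⊆ᴮ X → ¬ (X ⊆ᴮ Y) → next Y ⊆ᴮ X

  -- At a successor with `Y` below `X`, either `Y` is strictly below and extremity applies, or the
  -- two sets coincide and so do their successors. At a union, either some member lies above
  -- `next X`, or all members lie below `X`.
  extreme-compares : ∀ {X Y} → Extreme X → Tower Y → Y ⊆ᴮ X ⊎ next X ⊆ᴮ Y
  extreme-compares {X} ex (next-tower {Y} t) with extreme-compares ex t
  ... | inj₂ X⁺⊆Y = inj₂ (next-extensive Y ∘ X⁺⊆Y)
  ... | inj₁ Y⊆X with em {X ⊆ᴮ Y}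
  ...   | no X⊈Y  = inj₁ (ex t Y⊆X X⊈Y)
  ...   | yes X⊆Y with refl ← ⊆-antisym X Y X⊆Y Y⊆X = inj₂ id
  extreme-compares {X} ex (⋃-tower C h) with em {∃ λ Z → C Z ≡ true × next X ⊆ᴮ Z}
  ... | yes (Z , CZ , X⁺⊆Z) = inj₂ (⋃-upper C CZ ∘ X⁺⊆Z)
  ... | no none = inj₁ (⋃-least C λ {Z} CZ →
    [ id , (λ X⁺⊆Z → contradiction (Z , CZ , λ {a} → X⁺⊆Z {a}) none) ]′
      (extreme-compares ex (h CZ)))

  tower-extreme : ∀ {X} → Tower X → Extreme X
  tower-extreme (next-tower {X} t) {Y} u Y⊆X⁺ X⁺⊈Y
    with extreme-compares (tower-extreme t) u
  ... | inj₂ X⁺⊆Y = contradiction (λ {a} → X⁺⊆Y {a}) X⁺⊈Y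
  ... | inj₁ Y⊆X with em {X ⊆ᴮ Y}
  ...   | no X⊈Y  = next-extensive X ∘ tower-extreme t u Y⊆X X⊈Y
  ...   | yes X⊆Y with refl ← ⊆-antisym X Y X⊆Y Y⊆X = id
  tower-extreme (⋃-tower C h) {Y} u Y⊆⋃ ⋃⊈Y
    with em {∃ λ Z → C Z ≡ true × ¬ (Z ⊆ᴮ Y)}
  ... | no none = contradiction
    (λ {a} → ⋃-least C (λ {Z} CZ {b} → below Z CZ {b}) {a}) ⋃⊈Y
    where
    below : ∀ Z → C Z ≡ true → Z ⊆ᴮ Y
    below Z CZ with em {Z ⊆ᴮ Y}
    ... | yes p = p
    ... | no ¬p = contradiction (Z , CZ , ¬p) none
  ... | yes (Z , CZ , Z⊈Y) with extreme-compares (tower-extreme (h CZ)) u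
  ...   | inj₁ Y⊆Z  = ⋃-upper C CZ ∘ tower-extreme (h CZ) u Y⊆Z Z⊈Y
  ...   | inj₂ Z⁺⊆Y = contradiction (λ {a} → Z⁺⊆Y ∘ next-extensive Z {a}) Z⊈Y

  tower-total : ∀ {X Y} → Tower X → Tower Y → X ⊆ᴮ Y ⊎ Y ⊆ᴮ X
  tower-total {X} t u with extreme-compares (tower-extreme t) u
  ... | inj₁ Y⊆X  = inj₂ Y⊆X
  ... | inj₂ X⁺⊆Y = inj₁ (X⁺⊆Y ∘ next-extensive X)

  -- The list is nonempty because an empty family has no member to return; the empty list is covered
  -- by `good-[]`.
  chain-finite : ∀ C → (∀ {X} → C X ≡ true → Tower X) → ∀ {x xs} →
    All (_∈ᴮ ⋃ C) (x ∷ xs) → ∃ λ X → C X ≡ true × All (_∈ᴮ X) (x ∷ xs)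
  chain-finite C h (p ∷ []) with ∈-comprehend⁻ (Union C) p
  ... | X , CX , x∈X = X , CX , x∈X ∷ []
  chain-finite C h (p ∷ ps@(_ ∷ _)) with ∈-comprehend⁻ (Union C) p | chain-finite C h ps
  ... | X , CX , x∈X | Y , CY , xs∈Y with tower-total (h CX) (h CY)
  ...   | inj₁ X⊆Y = Y , CY , X⊆Y x∈X ∷ xs∈Y
  ...   | inj₂ Y⊆X = X , CX , x∈X ∷ All.map (λ p → Y⊆X p) xs∈Y

  tower-good : ∀ {X} → Tower X → Good X
  tower-good (next-tower {X} t) = next-good X (tower-good t)
  tower-good (⋃-tower C h) _ []         = good-[]
  tower-good (⋃-tower C h) _ ps@(_ ∷ _) with chain-finite C h ps
  ... | X , CX , qs = tower-good (h CX) _ qs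

  towers : 𝒫 → Bool
  towers X = does (em {Tower X})

  towers-tower : ∀ {X} → towers X ≡ true → Tower X
  towers-tower {X} _ with em {Tower X}
  towers-tower _ | yes t = t

  tower-towers : ∀ {X} → Tower X → towers X ≡ true
  tower-towers {X} t with em {Tower X}
  ... | yes _ = refl
  ... | no ¬t = contradiction t ¬t

  maximal : 𝒫
  maximal = ⋃ towers

  maximal-tower : Tower maximal
  maximal-tower = ⋃-tower towers towers-tower

  maximal-good : Good maximal
  maximal-good = tower-good maximal-tower

  -- The tower contains its own union, hence also the successor of that union, which lies below the
  -- union and so can bring nothing new.
  not-addable : ∀ {a} → ¬ Addable maximal a
  not-addable add with next-new maximal add
  ... | b , b∉ , b∈ = b∉ (⋃-upper towers (tower-towers (next-tower maximal-tower)) b∈)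

  separate : ∀ {a X xs} → All (_∈ᴮ insert a X) xs → ∃ λ ys → All (_∈ᴮ X) ys × xs ⊆ᴸ (a ∷ ys)
  separate [] = [] , [] , λ ()
  separate {a} {X} (p ∷ ps) with separate {a} {X} ps | ∈-comprehend⁻ (Insert a X) p
  ... | ys , qs , s | inj₁ refl = ys , qs , λ { (here eq) → here eq ; (there r) → s r }
  ... | ys , qs , s | inj₂ x∈X  = _ ∷ ys , x∈X ∷ qs ,
    λ { (here refl) → there (here refl) ; (there r) → skip (s r) }
    where
    skip : ∀ {x y z} {zs : List A} → x ∈ᴸ (y ∷ zs) → x ∈ᴸ (y ∷ z ∷ zs)
    skip (here eq) = here eq
    skip (there r) = there (there r)

  maximal-bad : ∀ {a} → ¬ (a ∈ᴮ maximal) → ∃ λ xs → All (_∈ᴮ maximal) xs × Bad (a ∷ xs)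
  maximal-bad {a} a∉ with em {∃ λ xs → All (_∈ᴮ maximal) xs × Bad (a ∷ xs)}
  ... | yes p   = p
  ... | no none = contradiction (a∉ , good) not-addable
    where
    good : Good (insert a maximal)
    good _ ps bad with separate {a} {maximal} ps
    ... | ys , qs , s = none (ys , qs , bad-mono s bad)

-- The canonical valuation

module Canonical {ℓ} (em : ExcludedMiddle ℓ) (Θ : Signature ℓ) (L : Logic)
  (Γ : Pred (Formula Θ) ℓ)
  (consistent : ∀ {φ} → Γ ⊢⟨ L ⟩ φ → ¬ (Γ ⊢⟨ L ⟩ ¬̇ φ))
  (complete : ∀ {φ} → Closed φ → ¬ (Γ ⊢⟨ L ⟩ φ) → Γ ⊢⟨ L ⟩ ¬̇ φ)
  (someConst : Const Θ)
  (henkin : ∀ x φ → Closed (∀̇ x φ) → ∃ λ c → Γ ⊢⟨ L ⟩ φ [ x / con c ] ⇒ ∀̇ x φ)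
  where
  open Derivation em Θ

  Holds Necessary Possible : Formula Θ → Set ℓ
  Holds     φ = Γ ⊢⟨ L ⟩ φ
  Necessary φ = Γ ⊢⟨ L ⟩ □ φ
  Possible  φ = Γ ⊢⟨ L ⟩ ◇ φ

  -- Each clause records only the nearest failure: for closed formulas `Necessary` implies `Holds`,
  -- which implies `Possible`.
  Graded : TV → Formula Θ → Set ℓ
  Graded 𝐓 φ = Necessary φ
  Graded 𝐭 φ = ¬ Necessary φ × Holds φ
  Graded 𝐟 φ = ¬ Holds φ × Possible φ
  Graded 𝐅 φ = ¬ Possible φ

  grading : ∀ φ → ∃ λ a → Graded a φ
  grading φ with em {Necessary φ} | em {Holds φ} | em {Possible φ}
  ... | yes n | _     | _     = 𝐓 , n
  ... | no ¬n | yes h | _     = 𝐭 , ¬n , h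
  ... | no _  | no ¬h | yes p = 𝐟 , ¬h , p
  ... | no _  | no _  | no ¬p = 𝐅 , ¬p

  grade : Formula Θ → TV
  grade φ = proj₁ (grading φ)

  necessary⇒holds : ∀ {φ} → Necessary φ → Holds φ
  necessary⇒holds n = mp n (tm (T _))

  -- `◇ φ` is by definition the negation of `□ (¬̇ φ)`, so this is completeness at that sentence.
  possible⁺ : ∀ {φ} → Closed φ → ¬ Necessary (¬̇ φ) → Possible φ
  possible⁺ = complete

  possible⁻ : ∀ {φ} → Possible φ → ¬ Necessary (¬̇ φ)
  possible⁻ p n = consistent n p

  impossible : ∀ {φ} → Closed φ → ¬ Possible φ → Necessary (¬̇ φ)
  impossible {φ} cl ¬p with em {Necessary (¬̇ φ)}
  ... | yes n = n
  ... | no ¬n = contradiction (possible⁺ cl ¬n) ¬p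

  holds⇒possible : ∀ {φ} → Closed φ → Holds φ → Possible φ
  holds⇒possible cl h = possible⁺ cl λ n → consistent h (necessary⇒holds n)

  graded-unique : ∀ {φ} → Closed φ → ∀ a b → Graded a φ → Graded b φ → a ≡ b
  graded-unique cl 𝐓 𝐓 _ _ = refl
  graded-unique cl 𝐓 𝐭 n (¬n , _) = contradiction n ¬n
  graded-unique cl 𝐓 𝐟 n (¬h , _) = contradiction (necessary⇒holds n) ¬h
  graded-unique cl 𝐓 𝐅 n ¬p = contradiction (holds⇒possible cl (necessary⇒holds n)) ¬p
  graded-unique cl 𝐭 𝐭 _ _ = refl
  graded-unique cl 𝐭 𝐟 (_ , h) (¬h , _) = contradiction h ¬h
  graded-unique cl 𝐭 𝐅 (_ , h) ¬p = contradiction (holds⇒possible cl h) ¬p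
  graded-unique cl 𝐟 𝐟 _ _ = refl
  graded-unique cl 𝐟 𝐅 (_ , p) ¬p = contradiction p ¬p
  graded-unique cl 𝐅 𝐅 _ _ = refl
  graded-unique cl 𝐭 𝐓 (¬n , _) n = contradiction n ¬n
  graded-unique cl 𝐟 𝐓 (¬h , _) n = contradiction (necessary⇒holds n) ¬h
  graded-unique cl 𝐅 𝐓 ¬p n = contradiction (holds⇒possible cl (necessary⇒holds n)) ¬p
  graded-unique cl 𝐟 𝐭 (¬h , _) (_ , h) = contradiction h ¬h
  graded-unique cl 𝐅 𝐭 ¬p (_ , h) = contradiction (holds⇒possible cl h) ¬p
  graded-unique cl 𝐅 𝐟 ¬p (_ , p) = contradiction p ¬p

  -- The equation is oriented so as to be membership of `grade φ` in a singleton; a single-valued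
  -- table entry is thus verified by exhibiting the grade.
  grade-is : ∀ {φ} → Closed φ → ∀ {a} → Graded a φ → a ≡ grade φ
  grade-is {φ} cl g = graded-unique cl _ _ g (proj₂ (grading φ))

  grade-designated : ∀ {φ} → Holds φ → Closed φ → grade φ ∈ Designated
  grade-designated h cl =
    Sum.map (grade-is cl) (λ ¬n → grade-is cl (¬n , h)) (toSum em)

  grade-undesignated : ∀ {φ} → ¬ Holds φ → Closed φ → grade φ ∈ ｛ 𝐟 ｝ ∪ ｛ 𝐅 ｝
  grade-undesignated ¬h cl =
    Sum.map (λ p → grade-is cl (¬h , p)) (grade-is cl) (toSum em)

  designated-holds : ∀ {φ} → grade φ ∈ Designated → Holds φ
  designated-holds {φ} d with grading φ
  ... | 𝐓 , n     = necessary⇒holds n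
  ... | 𝐭 , _ , h = h
  ... | 𝐟 , _     = contradiction d 𝐟-undesignated
  ... | 𝐅 , _     = contradiction d 𝐅-undesignated

  grade-¬ : ∀ {φ} → Closed φ → ∀ a → Graded a φ → grade (¬̇ φ) ∈ ¬̃ a
  grade-¬ cl 𝐓 n        = grade-is cl λ p → possible⁻ p (mp n (tm (DN1 _)))
  grade-¬ cl 𝐭 (¬n , h) = grade-is cl
    (consistent h , possible⁺ cl λ n → ¬n (mp n (tm (DN2 _))))
  grade-¬ cl 𝐟 (¬h , p) = grade-is cl (possible⁻ p , complete cl ¬h)
  grade-¬ cl 𝐅 ¬p       = grade-is cl (impossible cl ¬p)

  module _ {φ ψ : Formula Θ} (clφ : Closed φ) (clψ : Closed ψ) where

    cl⇒ : Closed (φ ⇒ ψ)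
    cl⇒ = closed-⇒ {φ = φ} {ψ} clφ clψ

    ¬holds-⇒ : Holds φ → ¬ Holds ψ → ¬ Holds (φ ⇒ ψ)
    ¬holds-⇒ h ¬h i = ¬h (mp h i)

    holds-⇒ : ¬ Holds φ ⊎ Holds ψ → Holds (φ ⇒ ψ)
    holds-⇒ (inj₁ ¬h) = deduction clφ (explosion assume (drop-hyp (complete clφ ¬h)))
    holds-⇒ (inj₂ h)  = mp h (tm (Ax1 _ _))

    ¬possible⇒¬holds : ¬ Possible ψ → ¬ Holds ψ
    ¬possible⇒¬holds ¬p h = ¬p (holds⇒possible clψ h)

    -- `M1` settles row 𝐅, `M2` the rest of column 𝐓, `M3` possibility in column 𝐟; `K`, `K2`, `M4`
    -- and `K1` settle 𝐓𝐭, 𝐓𝐅, 𝐭𝐅 and 𝐟𝐅. Entries with two values ask only that the implication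
    -- hold.
    grade-⇒ : ∀ a b → Graded a φ → Graded b ψ → grade (φ ⇒ ψ) ∈ (a →̃ b)
    grade-⇒ 𝐓 𝐓 n n′        = grade-is cl⇒ (mp n′ (tm (M2 _ _)))
    grade-⇒ 𝐓 𝐭 n (¬n , h)  = grade-is cl⇒ ((λ i → ¬n (mp₂ (tm (K _ _)) i n)) , holds-⇒ (inj₂ h))
    grade-⇒ 𝐓 𝐟 n (¬h , p)  = grade-is cl⇒ (¬holds-⇒ (necessary⇒holds n) ¬h , mp p (tm (M3 _ _)))
    grade-⇒ 𝐓 𝐅 n ¬p        = grade-is cl⇒ λ i → ¬p (mp₂ (tm (K2 _ _)) i n)
    grade-⇒ 𝐭 𝐓 _ n         = grade-is cl⇒ (mp n (tm (M2 _ _)))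
    grade-⇒ 𝐭 𝐭 _ (_ , h)   = grade-designated (holds-⇒ (inj₂ h)) cl⇒
    grade-⇒ 𝐭 𝐟 (_ , h) (¬h , p) = grade-is cl⇒ (¬holds-⇒ h ¬h , mp p (tm (M3 _ _)))
    grade-⇒ 𝐭 𝐅 (¬n , h) ¬p = grade-is cl⇒
      ( ¬holds-⇒ h (¬possible⇒¬holds ¬p)
      , mp (possible⁺ clφ λ n → ¬n (mp n (tm (DN2 _)))) (tm (M4 _ _)))
    grade-⇒ 𝐟 𝐓 _ n         = grade-is cl⇒ (mp n (tm (M2 _ _)))
    grade-⇒ 𝐟 𝐭 _ (_ , h)   = grade-designated (holds-⇒ (inj₂ h)) cl⇒
    grade-⇒ 𝐟 𝐟 (¬h , _) _  = grade-designated (holds-⇒ (inj₁ ¬h)) cl⇒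
    grade-⇒ 𝐟 𝐅 (¬h , p) ¬p = grade-is cl⇒
      ( (λ n → possible⁻ p (mp₂ (tm (K1 _ _)) n (impossible clψ ¬p)))
      , holds-⇒ (inj₁ ¬h))
    grade-⇒ 𝐅 𝐓 ¬p _        = grade-is cl⇒ (mp (impossible clφ ¬p) (tm (M1 _ _)))
    grade-⇒ 𝐅 𝐭 ¬p _        = grade-is cl⇒ (mp (impossible clφ ¬p) (tm (M1 _ _)))
    grade-⇒ 𝐅 𝐟 ¬p _        = grade-is cl⇒ (mp (impossible clφ ¬p) (tm (M1 _ _)))
    grade-⇒ 𝐅 𝐅 ¬p _        = grade-is cl⇒ (mp (impossible clφ ¬p) (tm (M1 _ _)))

  ¬necessary : ∀ {φ} → Closed φ → ∀ a → a ≢ 𝐓 → Graded a φ → ¬ Necessary φ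
  ¬necessary cl a a≢T g n = a≢T (sym (graded-unique cl 𝐓 a n g))


  grade-□ : ∀ L′ → L ≡ L′ → ∀ {φ} → Closed φ → ∀ a → Graded a φ → grade (□ φ) ∈ □̃ L′ a
  grade-□ Tm*  _    cl 𝐓 n = grade-designated n cl
  grade-□ S4m* refl cl 𝐓 n = grade-is cl (mp n (ax (four _)))
  grade-□ S5m* refl cl 𝐓 n = grade-is cl (mp n (ax (S4m (four _))))
  grade-□ Tm*  _    cl 𝐭 g = grade-undesignated (¬necessary cl 𝐭 (λ ()) g) cl
  grade-□ Tm*  _    cl 𝐟 g = grade-undesignated (¬necessary cl 𝐟 (λ ()) g) cl
  grade-□ Tm*  _    cl 𝐅 g = grade-undesignated (¬necessary cl 𝐅 (λ ()) g) cl
  grade-□ S4m* _    cl 𝐭 g = grade-undesignated (¬necessary cl 𝐭 (λ ()) g) cl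
  grade-□ S4m* _    cl 𝐟 g = grade-undesignated (¬necessary cl 𝐟 (λ ()) g) cl
  grade-□ S4m* _    cl 𝐅 g = grade-undesignated (¬necessary cl 𝐅 (λ ()) g) cl
  grade-□ S5m* refl cl 𝐭 g = grade-is cl λ p → ¬necessary cl 𝐭 (λ ()) g (mp p (ax (five _)))
  grade-□ S5m* refl cl 𝐟 g = grade-is cl λ p → ¬necessary cl 𝐟 (λ ()) g (mp p (ax (five _)))
  grade-□ S5m* refl cl 𝐅 g = grade-is cl λ p → ¬necessary cl 𝐅 (λ ()) g (mp p (ax (five _)))

  -- Variance is a congruence for `□` and `¬̇`, so `Ax6` transfers all three judgements that define
  -- the grade.
  grade-∼ : ∀ {φ ψ} → Closed φ → Closed ψ → φ ∼ ψ → grade φ ≡ grade ψ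
  grade-∼ {φ} {ψ} clφ clψ φ∼ψ =
    graded-unique clψ _ _ (transfer (grade φ) (proj₂ (grading φ))) (proj₂ (grading ψ))
    where
    along : ∀ {χ ξ} → χ ∼ ξ → Holds χ → Holds ξ
    along χ∼ξ h = mp h (tm (Ax6 _ _ χ∼ξ))
    transfer : ∀ a → Graded a φ → Graded a ψ
    transfer 𝐓 n = along (∼-□ φ∼ψ) n
    transfer 𝐭 (¬n , h) = ¬n ∘ along (∼-□ (∼-sym φ∼ψ)) , along φ∼ψ h
    transfer 𝐟 (¬h , p) = ¬h ∘ along (∼-sym φ∼ψ) , along (∼-¬ (∼-□ (∼-¬ φ∼ψ))) p
    transfer 𝐅 ¬p = ¬p ∘ along (∼-¬ (∼-□ (∼-¬ (∼-sym φ∼ψ))))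

  module _ {x : Var} {φ : Formula Θ} (cl : Closed (∀̇ x φ)) where

    clᶜ : ∀ c → Closed (φ [ x / con c ])
    clᶜ c = closed-instance x φ c cl

    holds-instance : ∀ ψ → Holds (∀̇ x ψ) → ∀ c → Holds (ψ [ x / con c ])
    holds-instance ψ h c = ∀-elim {φ = ψ} (con c) (freeFor-con ψ) h

    counterexample : ∀ ψ → Closed (∀̇ x ψ) → ¬ Holds (∀̇ x ψ) →
      ∃ λ c → ¬ Holds (ψ [ x / con c ])
    counterexample ψ clψ ¬h with henkin x ψ clψ
    ... | c , i = c , λ h → ¬h (mp h i)

    grade-≥ : ∀ a → Graded a (∀̇ x φ) → ∀ c → a ≤ᵗ grade (φ [ x / con c ])
    grade-≥ 𝐓 n c = ℕ.≤-reflexive (cong rank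
      (grade-is (clᶜ c) (holds-instance (□ φ) (mp n (tm (CBF _ _))) c)))
    grade-≥ 𝐭 (_ , h) c with grade-designated (holds-instance φ h c) (clᶜ c)
    ... | inj₁ eq = ≡.subst (λ a → 𝐭 ≤ᵗ a) eq (s≤s (s≤s z≤n))
    ... | inj₂ eq = ≡.subst (λ a → 𝐭 ≤ᵗ a) eq ℕ.≤-refl
    grade-≥ 𝐟 (_ , p) c with grading (φ [ x / con c ])
    ... | 𝐓 , _  = s≤s z≤n
    ... | 𝐭 , _  = s≤s z≤n
    ... | 𝐟 , _  = s≤s z≤n
    ... | 𝐅 , ¬p = contradiction (holds-instance (◇ φ) (mp p (tm (PBF _ _))) c) ¬p
    grade-≥ 𝐅 _ c = z≤n

    -- At 𝐓 every instance has this value. Otherwise a counterexample attains the minimum: to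
    -- `∀̇ x (□ φ)` by `BF` at 𝐭, to `∀̇ x φ` itself at 𝐟, to `∀̇ x (◇ φ)` by `NBF` at 𝐅.
    grade-attained : ∀ a → Graded a (∀̇ x φ) → ∃ λ c → grade (φ [ x / con c ]) ≡ a
    grade-attained 𝐓 n = someConst ,
      sym (grade-is (clᶜ someConst) (holds-instance (□ φ) (mp n (tm (CBF _ _))) someConst))
    grade-attained 𝐭 (¬n , h) with counterexample (□ φ) cl (λ h → ¬n (mp h (tm (BF _ _))))
    ... | c , ¬nᶜ = c , sym (grade-is (clᶜ c) (¬nᶜ , holds-instance φ h c))
    grade-attained 𝐟 (¬h , p) with counterexample φ cl ¬h
    ... | c , ¬hᶜ = c , sym (grade-is (clᶜ c) (¬hᶜ , holds-instance (◇ φ) (mp p (tm (PBF _ _))) c))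
    grade-attained 𝐅 ¬p with counterexample (◇ φ) cl (λ h → ¬p (mp h (tm (NBF _ _))))
    ... | c , ¬pᶜ = c , sym (grade-is (clᶜ c) ¬pᶜ)

  -- Excluded middle decides closedness, which allows its irrelevant proof to be recovered.
  closed : (χ : Sen Θ) → Closed (value χ)
  closed (φ ,ʳ Irrelevant.[ cl ]) = recompute em cl

-- Henkin witnesses and conservativity

module Witnesses {ℓ} (em : ExcludedMiddle ℓ) (Θ : Signature ℓ) (L : Logic) where
  open Syntax Θ
  open Derivation em Θ

  -- A witness carries the formula that it witnesses, so the Henkin axiom is a
  -- function of the constant, and the stages bound its occurrences.
  Stage : ℕ → Set ℓ
  Stage zero    = Const Θ
  Stage (suc n) = Stage n ⊎ (Var × For (Stage n))

  Witness : Set ℓ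
  Witness = ∃ λ n → Var × For (Stage n)

  -- `Const Θ` may be empty; the predicate symbol of the signature still provides a formula, hence a
  -- witness.
  someWitness : Witness
  someWitness = 0 , 0 , atom (somePred Θ) (Vec.replicate _ (var 0))

  stage : Witness → ℕ
  stage = proj₁

  -- Constants denote themselves, so the elements without a name in `Θ` are exactly the witnesses,
  -- and the new constants of the diagram language are the Henkin constants.
  frame : ((P : PredSym Θ) → Vec (Const Θ ⊎ Witness) (arity Θ P) → TV) → Structure Θ
  frame interpretation = record
    { U        = Const Θ ⊎ Witness
    ; nonempty = inj₂ someWitness
    ; ⟦_⟧ᵖ     = interpretation
    ; ⟦_⟧ᶜ     = inj₁
    }

  -- The diagram signature of a frame does not depend on the interpretation of
  -- the predicates, which can therefore be defined from formulas over C⁺; C⁺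
  -- must match the definition of diagramSig up to definitional equality.
  C⁺ : Set ℓ
  C⁺ = Const Θ ⊎ [ a ∈ Const Θ ⊎ Witness ∣ ¬ (∃ λ c → inj₁ c ≡ a) ]

  new : Witness → C⁺
  new w = inj₂ (inj₂ w ,ʳ Irrelevant.pure λ ())

  new-injective : ∀ {w w′} → new w ≡ new w′ → w ≡ w′
  new-injective eq = inj₂-injective (cong value (inj₂-injective eq))

  include : ∀ n → Stage n → C⁺
  include zero    c              = inj₁ c
  include (suc n) (inj₁ c)       = include n c
  include (suc n) (inj₂ (x , φ)) = new (n , x , φ)

  include-stage : ∀ n c {w} → include n c ≡ new w → stage w < n
  include-stage (suc n) (inj₁ c)       eq = ℕ.m<n⇒m<1+n (include-stage n c eq)
  include-stage (suc n) (inj₂ (x , φ)) eq with refl ← new-injective eq = ℕ.n<1+n n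

  variable-of : Witness → Var
  variable-of (n , x , φ) = x

  matrix : Witness → For C⁺
  matrix (n , x , φ) = inst (con ∘ include n) var φ

  -- Subformulas may first appear at different stages; asking for all later stages lets them be
  -- combined at the maximum.
  Eventually : (ℕ → Set ℓ) → Set ℓ
  Eventually P = ∃ λ m → ∀ n → m ≤ n → P n

  eventually₂ : ∀ {P Q R : ℕ → Set ℓ} → (∀ {n} → P n → Q n → R n) →
    Eventually P → Eventually Q → Eventually R
  eventually₂ f (m , p) (m′ , q) = m ℕ.⊔ m′ , λ n le →
    f (p n (ℕ.≤-trans (ℕ.m≤m⊔n m m′) le)) (q n (ℕ.≤-trans (ℕ.m≤n⊔m m m′) le))

  eventually₁ : ∀ {P Q : ℕ → Set ℓ} → (∀ {n} → P n → Q n) → Eventually P → Eventually Q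
  eventually₁ f (m , p) = m , λ n le → f (p n le)

  constant-staged : ∀ c → Eventually (λ n → ∃ λ e → include n e ≡ c)
  constant-staged (inj₁ c) = 0 , λ n _ → old n
    where
    old : ∀ n → ∃ λ e → include n e ≡ inj₁ c
    old zero    = c , refl
    old (suc n) = Prod.map inj₁ id (old n)
  constant-staged (inj₂ (inj₁ c ,ʳ Irrelevant.[ p ])) = ⊥-elim-irr (p (c , refl))
  constant-staged (inj₂ (inj₂ w@(m , x , φ) ,ʳ _)) = suc m , λ n le → later n le
    where
    later : ∀ n → suc m ≤ n → ∃ λ e → include n e ≡ new w
    later (suc n) (s≤s le) with ℕ.m≤n⇒m<n∨m≡n le
    ... | inj₁ m<n  = Prod.map inj₁ id (later n m<n)
    ... | inj₂ refl = inj₂ (x , φ) , refl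

  term-staged : ∀ τ → Eventually (λ n → ∃ λ τ′ → instTerm (con ∘ include n) var τ′ ≡ τ)
  term-staged (var x) = 0 , λ _ _ → var x , refl
  term-staged (con c) = eventually₁ (λ (e , eq) → con e , cong con eq) (constant-staged c)

  terms-staged : ∀ {k} (τs : Vec (Ter C⁺) k) →
    Eventually (λ n → ∃ λ τs′ → Vec.map (instTerm (con ∘ include n) var) τs′ ≡ τs)
  terms-staged []       = 0 , λ _ _ → [] , refl
  terms-staged (τ ∷ τs) =
    eventually₂ (λ (τ′ , eq) (τs′ , eqs) → τ′ ∷ τs′ , cong₂ _∷_ eq eqs)
      (term-staged τ) (terms-staged τs)

  formula-staged : ∀ φ → Eventually (λ n → ∃ λ φ′ → inst (con ∘ include n) var φ′ ≡ φ)
  formula-staged (atom P τs) =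
    eventually₁ (λ (τs′ , eq) → atom P τs′ , cong (atom P) eq) (terms-staged τs)
  formula-staged (¬̇ φ) =
    eventually₁ (λ (φ′ , eq) → ¬̇ φ′ , cong ¬̇_ eq) (formula-staged φ)
  formula-staged (□ φ) =
    eventually₁ (λ (φ′ , eq) → □ φ′ , cong □_ eq) (formula-staged φ)
  formula-staged (φ ⇒ ψ) =
    eventually₂ (λ (φ′ , eq) (ψ′ , eq′) → φ′ ⇒ ψ′ , cong₂ _⇒_ eq eq′)
      (formula-staged φ) (formula-staged ψ)
  formula-staged (∀̇ x φ) = eventually₁ (λ (φ′ , eq) → ∀̇ x φ′ , cong (∀̇ x)
      (trans (inst-agree φ′ (λ _ → refl) (↦-var-id var φ′ (λ _ → refl))) eq))
    (formula-staged φ)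

  -- A formula has finitely many constants and thus already lives at a finite stage, so ω stages
  -- suffice.
  witness-for : ∀ x φ → ∃ λ w → variable-of w ≡ x × matrix w ≡ φ
  witness-for x φ with formula-staged φ
  ... | n , h with h n ℕ.≤-refl
  ...   | φ′ , eq = (n , x , φ′) , refl , eq

  quantified henkinAxiom : Witness → For C⁺
  quantified  w = ∀̇ (variable-of w) (matrix w)
  henkinAxiom w = matrix w [ variable-of w / con (new w) ] ⇒ quantified w

  matrix-stage : ∀ w {w′} → new w OccursIn matrix w′ → stage w < stage w′
  matrix-stage w {n , x , φ} r with occurs-inst φ r
  ... | inj₁ (c , _ , eq) = include-stage n c (con-injective eq)
  ... | inj₂ (_ , ())

  -- The matrix of `w′` contains only witnesses of earlier stages, and the one further constant of
  -- its axiom is its own.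
  axiom-stage : ∀ w {w′} → new w OccursIn henkinAxiom w′ → stage w < stage w′ ⊎ w ≡ w′
  axiom-stage w {w′} (inj₂ r) = inj₁ (matrix-stage w {w′} r)
  axiom-stage w {w′} (inj₁ r)
    with occurs-inst (matrix w′) (≡.subst (new w OccursIn_) (subst≗inst _ (matrix w′)) r)
  ... | inj₁ (c , r′ , refl) = inj₁ (matrix-stage w {w′} r′)
  ... | inj₂ (y , eq) with y ≟ variable-of w′ | eq
  ...   | yes _ | eq′ = inj₂ (sym (new-injective (con-injective eq′)))
  ...   | no _  | ()

  -- Under `¬̇ χ` the Henkin axiom is refutable. A refuted implication has a derivable antecedent;
  -- generalising it over the witness gives the consequent and thereby the axiom, hence `χ`.
  eliminate-axiom : ∀ {Γ χ} w → Closed (quantified w) → Closed χ →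
    (∀ {γ} → γ ∈ Γ → ¬ (new w OccursIn γ)) → ¬ (new w OccursIn χ) →
    (Γ ∪ ｛ henkinAxiom w ｝) ⊢⟨ L ⟩ χ → Γ ⊢⟨ L ⟩ χ
  eliminate-axiom {Γ} {χ} w clw clχ w∉Γ w∉χ d = reductio clχ
    (mp (mp (gen-constant (matrix w) (λ r → ℕ.<-irrefl refl (matrix-stage w {w} r)) w∉
              (reductio clᵢ (explosion
                (mp (deduction clᵢ (explosion assume (drop-hyp assume)))
                    (drop-hyp (drop-hyp (deduction clA d))))
                (drop-hyp assume))))
            (tm (Ax1 _ _)))
        (drop-hyp (deduction clA d)))
    where
    ιw = matrix w [ variable-of w / con (new w) ]
    clᵢ : Closed ιw
    clᵢ = closed-instance (variable-of w) (matrix w) (new w) clw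
    clA : Closed (henkinAxiom w)
    clA = closed-⇒ {φ = ιw} {quantified w} clᵢ clw
    w∉ : ∀ {γ} → γ ∈ (Γ ∪ ｛ ¬̇ χ ｝) → ¬ (new w OccursIn γ)
    w∉ (inj₁ p)    = w∉Γ p
    w∉ (inj₂ refl) = w∉χ

  Proper : Witness → Set ℓ
  Proper w = Closed (quantified w)

  -- Witnesses of maximal stage do not occur in the other axioms, so the axioms
  -- can be removed stage by stage, from the top.
  eliminate-axioms : ∀ {Γ χ} → Closed χ →
    (∀ w {γ} → γ ∈ Γ → ¬ (new w OccursIn γ)) → (∀ w → ¬ (new w OccursIn χ)) →
    ∀ k ws vs → All (λ w → Proper w × stage w ≤ k) ws → All (λ w → Proper w × stage w < k) vs →
    (Γ ∪ (Among henkinAxiom ws ∪ Among henkinAxiom vs)) ⊢⟨ L ⟩ χ → Γ ⊢⟨ L ⟩ χ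
  eliminate-axioms {Γ} {χ} clχ new∉Γ new∉χ = go
    where
    go : ∀ k ws vs → All (λ w → Proper w × stage w ≤ k) ws →
      All (λ w → Proper w × stage w < k) vs →
      (Γ ∪ (Among henkinAxiom ws ∪ Among henkinAxiom vs)) ⊢⟨ L ⟩ χ → Γ ⊢⟨ L ⟩ χ
    go zero [] [] [] [] d = weaken (λ { (inj₁ p) → p ; (inj₂ (inj₁ ())) ; (inj₂ (inj₂ ())) }) d
    go zero [] (v ∷ vs) [] ((_ , ()) ∷ _) d
    -- No axiom of stage `suc k` is left; the postponed ones have stage at most `k` and form the
    -- next list.
    go (suc k) [] vs [] ps d =
      go k vs [] (All.map (Prod.map id ℕ.s≤s⁻¹) ps) []
        (weaken (λ { (inj₁ p) → inj₁ p ; (inj₂ (inj₂ r)) → inj₂ (inj₁ r) }) d)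
    go k (w ∷ ws) vs ((clw , w≤k) ∷ qs) ps d with stage w ℕ.<? k | em {w ∈ᴸ ws}
    ... | yes w<k | _ = go k ws (w ∷ vs) qs ((clw , w<k) ∷ ps) (weaken
      (λ { (inj₁ p) → inj₁ p
         ; (inj₂ (inj₁ (here eq))) → inj₂ (inj₂ (here eq))
         ; (inj₂ (inj₁ (there r))) → inj₂ (inj₁ r)
         ; (inj₂ (inj₂ r)) → inj₂ (inj₂ (there r)) }) d)
    -- With a second copy in `ws` the witness would still occur in the remaining axioms, so this
    -- copy is dropped and the later one eliminated.
    ... | no _ | yes w∈ws = go k ws vs qs ps (weaken
      (λ { (inj₁ p) → inj₁ p
         ; (inj₂ (inj₁ (here eq))) → inj₂ (inj₁ (lose w∈ws eq))
         ; (inj₂ (inj₁ (there r))) → inj₂ (inj₁ r)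
         ; (inj₂ (inj₂ r)) → inj₂ (inj₂ r) }) d)
    ... | no w≮k | no w∉ws = go k ws vs qs ps
      (eliminate-axiom w clw clχ w∉ (new∉χ w) (weaken
        (λ { (inj₁ p) → inj₁ (inj₁ p)
           ; (inj₂ (inj₁ (here eq))) → inj₂ eq
           ; (inj₂ (inj₁ (there r))) → inj₁ (inj₂ (inj₁ r))
           ; (inj₂ (inj₂ r)) → inj₁ (inj₂ (inj₂ r)) }) d))
      where
      k≤w = ℕ.≮⇒≥ w≮k
      w∉ : ∀ {γ} → γ ∈ (Γ ∪ (Among henkinAxiom ws ∪ Among henkinAxiom vs)) →
           ¬ (new w OccursIn γ)
      w∉ (inj₁ p) occ = new∉Γ w p occ
      w∉ (inj₂ (inj₁ r)) occ with find r
      ... | w′ , w′∈ , refl with axiom-stage w {w′} occ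
      ...   | inj₁ w<w′ = ℕ.<⇒≱ w<w′ (ℕ.≤-trans (proj₂ (All.lookup qs w′∈)) k≤w)
      ...   | inj₂ refl = w∉ws w′∈
      w∉ (inj₂ (inj₂ r)) occ with find r
      ... | w′ , w′∈ , refl with axiom-stage w {w′} occ
      ...   | inj₁ w<w′ = ℕ.<⇒≱ (ℕ.<-trans w<w′ (proj₂ (All.lookup ps w′∈))) k≤w
      ...   | inj₂ refl = ℕ.<⇒≱ (proj₂ (All.lookup ps w′∈)) k≤w

  lift⁺ : Formula Θ → For C⁺
  lift⁺ = inst (con ∘ inj₁) var

  lift⁺-fresh : ∀ {m} → Fresh {C = Const Θ} {D = C⁺} m (con ∘ inj₁) var
  con-fresh lift⁺-fresh ()
  var-fresh lift⁺-fresh refl = inj₁ refl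

  inst-lift⁺ : ∀ {D} {ρ : C⁺ → Ter D} {σ} (φ : Formula Θ) →
    inst ρ σ (lift⁺ φ) ≡ inst (ρ ∘ inj₁) σ φ
  inst-lift⁺ φ = inst-inst φ (fresh-noCapture φ lift⁺-fresh (below-bound φ))

  lift⁺-closed : ∀ {φ} → Closed φ → Closed (lift⁺ φ)
  lift⁺-closed {φ} cl x r with free-inst φ r
  ... | inj₁ (_ , r′ , refl) = cl x r′
  ... | inj₂ (_ , ())

  new∉lift⁺ : ∀ w φ → ¬ (new w OccursIn lift⁺ φ)
  new∉lift⁺ w φ r with occurs-inst φ r
  ... | inj₁ (_ , _ , ())
  ... | inj₂ (_ , ())

  module _ (Γ : Pred (Formula Θ) ℓ) where

    Γ⁺ Γᴴ : Pred (For C⁺) ℓ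
    Γ⁺ φ = ∃ λ γ → γ ∈ Γ × lift⁺ γ ≡ φ
    Γᴴ   = Γ⁺ ∪ (λ φ → ∃ λ w → Proper w × henkinAxiom w ≡ φ)

    -- New constants may occur inside the derivation, though not in its hypotheses or conclusion;
    -- one variable beyond the bound of the derivation replaces them all.
    lift⁺-conservative : ∀ {φ} → Γ⁺ ⊢⟨ L ⟩ lift⁺ φ → Γ ⊢⟨ L ⟩ φ
    lift⁺-conservative {φ} d = ≡.subst (Γ ⊢⟨ L ⟩_) (retract φ)
      (proj₂ (inst-⊢ d) (fresh-var ρ-range ℕ.≤-refl)
        λ { (γ , γ∈Γ , refl) → ≡.subst (_∈ Γ) (sym (retract γ)) γ∈Γ })
      where
      ρ : C⁺ → Term Θ
      ρ (inj₁ c) = con c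
      ρ (inj₂ _) = var (proj₁ (inst-⊢ {D = Const Θ} {Γ′ = Γ} d))
      ρ-range : ∀ {c z} → ρ c ≡ var z → proj₁ (inst-⊢ {D = Const Θ} {Γ′ = Γ} d) ≡ z
      ρ-range {inj₁ _} ()
      ρ-range {inj₂ _} eq = var-injective eq
      retract : ∀ γ → inst ρ var (lift⁺ γ) ≡ γ
      retract γ = trans (inst-lift⁺ γ) (inst-con-var γ)

    henkin-conservative : ∀ {φ} → Closed φ → Γᴴ ⊢⟨ L ⟩ lift⁺ φ → Γ ⊢⟨ L ⟩ φ
    henkin-conservative {φ} cl d with compactness henkinAxiom d
    ... | ws , proper , d′ = lift⁺-conservative
      (eliminate-axioms (lift⁺-closed {φ} cl)
        (λ { w (γ , _ , refl) → new∉lift⁺ w γ }) (λ w → new∉lift⁺ w φ)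
        (maxStage ws) ws [] (below-max ws proper) []
        (weaken (Sum.map id inj₁) d′))
      where
      maxStage : List Witness → ℕ
      maxStage []       = 0
      maxStage (w ∷ ws) = stage w ℕ.⊔ maxStage ws
      below-max : ∀ ws → All Proper ws → All (λ w → Proper w × stage w ≤ maxStage ws) ws
      below-max []       []       = []
      below-max (w ∷ ws) (p ∷ ps) =
        (p , ℕ.m≤m⊔n _ (maxStage ws)) ∷
        All.map (Prod.map id (λ le → ℕ.≤-trans le (ℕ.m≤n⊔m (stage w) _))) (below-max ws ps)

-- The canonical structure

module CanonicalModel {ℓ} (em : ExcludedMiddle ℓ) (Θ : Signature ℓ) (L : Logic)
  (Γ : Pred (Formula Θ) ℓ) (ψ : Formula Θ) (clψ : Closed ψ) where
  open Syntax Θ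
  open Derivation em Θ
  open Witnesses em Θ L

  ψ⁺ : For C⁺
  ψ⁺ = lift⁺ ψ

  clψ⁺ : Closed ψ⁺
  clψ⁺ = lift⁺-closed {ψ} clψ

  Proves-ψ : List (Sen (withConst C⁺)) → Set ℓ
  Proves-ψ χs = (Γᴴ Γ ∪ Among value χs) ⊢⟨ L ⟩ ψ⁺

  module _ (maximal : Sen (withConst C⁺) → Bool)
    (maximal-good : ∀ χs → All (λ χ → maximal χ ≡ true) χs → ¬ Proves-ψ χs)
    (maximal-bad : ∀ {χ} → ¬ (maximal χ ≡ true) →
      ∃ λ χs → All (λ χ → maximal χ ≡ true) χs × Proves-ψ (χ ∷ χs)) where

    -- `Γᴴ` may contain open formulas and is kept apart from the maximal set, whose members are
    -- sentences to which the deduction theorem applies.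
    Δ : Pred (For C⁺) ℓ
    Δ = Γᴴ Γ ∪ (λ φ → ∃ λ χ → Lift ℓ (maximal χ ≡ true) × value χ ≡ φ)

    Δ⊬ψ : ¬ (Δ ⊢⟨ L ⟩ ψ⁺)
    Δ⊬ψ d with compactness value d
    ... | χs , χs∈ , d′ = maximal-good χs (All.map lower χs∈) d′

    refutes : ∀ {φ} → Closed φ → ¬ (Δ ⊢⟨ L ⟩ φ) → (Δ ∪ ｛ φ ｝) ⊢⟨ L ⟩ ψ⁺
    refutes {φ} cl Δ⊬φ with maximal-bad {φ ,ʳ Irrelevant.pure cl}
      (λ φ∈ → Δ⊬φ (hyp (inj₂ (_ , lift φ∈ , refl))))
    ... | χs , χs∈ , d = weaken
      (λ { (inj₁ p) → inj₁ (inj₁ p)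
         ; (inj₂ (here eq)) → inj₂ eq
         ; (inj₂ (there r)) → inj₁ (inj₂ (member r)) }) d
      where
      member : ∀ {χ} → Among value χs χ → ∃ λ ξ → Lift ℓ (maximal ξ ≡ true) × value ξ ≡ χ
      member r with find r
      ... | ξ , ξ∈ , eq = ξ , lift (All.lookup χs∈ ξ∈) , eq

    complete : ∀ {φ} → Closed φ → ¬ (Δ ⊢⟨ L ⟩ φ) → Δ ⊢⟨ L ⟩ ¬̇ φ
    -- If neither sentence were derivable, maximality would let each of them yield `ψ⁺`, and by
    -- cases `Δ` alone would.
    complete {φ} cl Δ⊬φ = decidable-stable em λ Δ⊬¬φ →
      Δ⊬ψ (by-cases cl clψ⁺ (refutes cl Δ⊬φ) (refutes cl Δ⊬¬φ))

    henkin : ∀ x φ → Closed (∀̇ x φ) → ∃ λ c → Δ ⊢⟨ L ⟩ φ [ x / con c ] ⇒ ∀̇ x φ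
    henkin x φ cl with witness-for x φ
    ... | w , refl , refl = new w , hyp (inj₁ (inj₂ (w , cl , refl)))

    open Canonical em (withConst C⁺) L Δ (λ d e → Δ⊬ψ (explosion d e)) complete
      (new someWitness) henkin

    -- Inverse to the interpretation of the diagram constants; through it a predicate takes at given
    -- elements the grade of the atom with their names.
    name : Const Θ ⊎ Witness → C⁺
    name (inj₁ c) = inj₁ c
    name (inj₂ w) = new w

    𝔄 : Structure Θ
    𝔄 = frame λ P us → grade (atom P (Vec.map con (Vec.map name us)))

    name-⟦⟧ : ∀ c → name (Structure.⟦_⟧ᶜ (expansion 𝔄) c) ≡ c
    name-⟦⟧ (inj₁ c) = refl
    name-⟦⟧ (inj₂ (inj₁ c ,ʳ Irrelevant.[ p ])) = ⊥-elim-irr (p (c , refl))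
    name-⟦⟧ (inj₂ (inj₂ w ,ʳ _)) = refl

    canonical : Valuation L 𝔄
    canonical = record
      { v      = grade ∘ value
      ; v-atom = λ P cs → cong (grade ∘ atom P ∘ Vec.map con) (sym
          (trans (sym (Vec.map-∘ name _ cs)) (trans (Vec.map-cong name-⟦⟧ cs) (Vec.map-id cs))))
      ; v-¬    = λ φ → grade-¬ (closed φ) _ (proj₂ (grading (value φ)))
      ; v-□    = λ φ → grade-□ L refl (closed φ) _ (proj₂ (grading (value φ)))
      ; v-⇒    = λ φ χ → grade-⇒ (closed φ) (closed χ) _ _
                           (proj₂ (grading (value φ))) (proj₂ (grading (value χ)))
      ; v-∀    = λ x φ p → let cl = closed (∀̇ x φ ,ʳ p) ; g = proj₂ (grading (∀̇ x φ)) in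
          grade-attained cl _ g , λ { (c , refl) → grade-≥ cl _ g c }
      ; v-∼    = λ {φ} {χ} → grade-∼ (closed φ) (closed χ)
      }

    subst-lift⁺ : ∀ s φ → subst (con ∘ s) (embed 𝔄 φ) ≡ subst (con ∘ s) (lift⁺ φ)
    subst-lift⁺ s φ = trans (Embedding.subst-embed 𝔄 _ φ)
      (sym (trans (subst≗inst _ (lift⁺ φ)) (inst-lift⁺ φ)))

    refuted : ¬ (Γ ⊨⟨ L ⟩ ψ)
    refuted Γ⊨ψ = Δ⊬ψ (≡.subst (Δ ⊢⟨ L ⟩_) ground-ψ (designated-holds (Γ⊨ψ 𝔄 canonical model s₀)))
      where
      s₀ : Var → C⁺
      -- `ψ` is closed, so any assignment would do.
      s₀ _ = new someWitness
      model : ∀ {γ} → γ ∈ Γ → ∀ s → grade (subst (con ∘ s) (embed 𝔄 γ)) ∈ Designated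
      model {γ} γ∈Γ s = grade-designated
        (≡.subst (Δ ⊢⟨ L ⟩_) (sym (subst-lift⁺ s γ))
          (all-instances s (hyp (inj₁ (inj₁ (γ , γ∈Γ , refl))))))
        (closed-ground s (embed 𝔄 γ))
      ground-ψ : subst (con ∘ s₀) (embed 𝔄 ψ) ≡ ψ⁺
      ground-ψ = trans (subst-lift⁺ s₀ ψ) (trans (subst≗inst _ ψ⁺)
        (inst-id ψ⁺ (λ _ → refl) (λ {x} r → contradiction r (clψ⁺ x))))

-- Completeness for sentences and for open formulas

⊨⇒⊢-closed : ∀ {ℓ} → ExcludedMiddle ℓ → Extensionality ℓ Level.zero →
  ∀ L {Θ : Signature ℓ} {Γ : Pred (Formula Θ) ℓ} {ψ} → Closed ψ → Γ ⊨⟨ L ⟩ ψ → Γ ⊢⟨ L ⟩ ψ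
⊨⇒⊢-closed em ext L {Θ} {Γ} {ψ} clψ Γ⊨ψ = decidable-stable em λ Γ⊬ψ →
  let open Lindenbaum em ext Proves-ψ
        (λ s → weaken (Sum.map id (Any-resp-⊆ s)))
        (λ d → Γ⊬ψ (henkin-conservative Γ clψ (weaken [ id , (λ ()) ]′ d)))
  in refuted maximal maximal-good maximal-bad Γ⊨ψ
  where
  open Derivation em Θ
  open Witnesses em Θ L
  open CanonicalModel em Θ L Γ ψ clψ

mainTheorem1 : (∀ {a : Level} → ExcludedMiddle a) →
    (∀ {a b : Level} → Extensionality a b) →
    ∀ {ℓ : Level} (L : Logic) (Θ : Signature ℓ)
    (Γ : Pred (Formula Θ) ℓ) (φ : Formula Θ) →
    (Γ ⊨⟨ L ⟩ φ) ⇔ (Γ ⊢⟨ L ⟩ φ)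
mainTheorem1 em ext {ℓ} L Θ Γ φ = mk⇔ completeness soundness
  where
  open Syntax Θ
  open Derivation (em {ℓ}) Θ

  soundness : Γ ⊢⟨ L ⟩ φ → Γ ⊨⟨ L ⟩ φ
  soundness d 𝔄 V Γ-holds = Soundness.sound em 𝔄 V (λ {γ} → Γ-holds {γ}) d

  -- The conclusion of a consequence is required under all assignments, and this is preserved by
  -- generalisation.
  ⊨-closure : ∀ n → Γ ⊨⟨ L ⟩ φ → Γ ⊨⟨ L ⟩ closure n φ
  ⊨-closure zero    h = h
  ⊨-closure (suc n) h 𝔄 V Γ-holds =
    Soundness.gen-sound em 𝔄 V {φ = closure n φ} (⊨-closure n h 𝔄 V Γ-holds)

  completeness : Γ ⊨⟨ L ⟩ φ → Γ ⊢⟨ L ⟩ φ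
  completeness h = closure-elim (bound φ) 
    (⊨⇒⊢-closed em ext L (closure-closed φ) (⊨-closure (bound φ) h))
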